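{- Let $H\in\{H_1,H_2\}$. For all integers $k\ge 1$ and $r$ with $0\le r\le k$, \[GR_k((k-r)K_3,rH)=\begin{cases}5^{(k-r)/2}\cdot 17^{r/2}+1, & \text{if } k-r \text{ and } r \text{ are both even},\\ 2\cdot 5^{(k-r-1)/2}\cdot 17^{r/2}+1, & \text{if } k-r \text{ is odd and } r \text{ is even},\\ 8\cdot 5^{(k-r-1)/2}\cdot 17^{(r-1)/2}+1, & \text{if } k-r \text{ and } r \text{ are both odd},\\ 4\cdot 5^{(k-r)/2}\cdot 17^{(r-1)/2}+1, & \text{if } k-r \text{ is even and } r \text{ is odd}.\end{cases}\]
   Context: All graphs are finite, simple and undirected. $K_n$ denotes the complete graph on $n$ vertices. $H_1$ is the 5-vertex graph consisting of $K_4$ together with one additional vertex adjacent to exactly one vertex of the $K_4$; $H_2$ is the 5-vertex graph consisting of $K_4$ together with one additional vertex adjacent to exactly two vertices of the $K_4$. An edge coloring of a complete graph is a Gallai coloring if it contains no rainbow triangle (a triangle whose three edges receive three distinct colors). For graphs $F_1,\dots,F_k$, $GR(F_1,\dots,F_k)$ is the minimum integer $n$ such that every Gallai coloring of $K_n$ with colors $1,\dots,k$ contains, for some $i\in\{1,\dots,k\}$, a monochromatic copy of $F_i$ in color $i$. The notation $GR_k((k-r)K_3,rH)$ means $GR(F_1,\dots,F_k)$ with $F_1=\dots=F_r=H$ and $F_{r+1}=\dots=F_k=K_3$; i.e., the first $r$ colors are assigned to $H$ and the last $k-r$ colors are assigned to $K_3$. -}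

module Defs where

open import Data.Nat using (ℕ; zero; suc; _+_; _*_; _∸_; _^_; _<_; _/_; _%_)
open import Data.Fin using (Fin; toℕ)
open import Data.Fin.Patterns
open import Data.Bool using (Bool; true; false; if_then_else_)
open import Data.Nat using (_<ᵇ_)
open import Data.Product using (Σ; ∃; _×_; _,_; proj₂)
open import Relation.Binary.PropositionalEquality using (_≡_; _≢_)
open import Relation.Nullary using (¬_)
open import Function.Definitions using (Injective)

Graph : ℕ → Set
Graph m = Fin m → Fin m → Bool

K3 : Graph 3
K3 0F 0F = false
K3 1F 1F = false
K3 2F 2F = false
K3 _  _  = true

-- H_1 : K_4 on {0,1,2,3} plus vertex 4 adjacent exactly to 0
H1 : Graph 5
H1 4F 0F = true
H1 0F 4F = true
H1 4F _  = false
H1 _  4F = false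
H1 0F 0F = false
H1 1F 1F = false
H1 2F 2F = false
H1 3F 3F = false
H1 _  _  = true

-- H_2 : K_4 on {0,1,2,3} plus vertex 4 adjacent exactly to 0 and 1
H2 : Graph 5
H2 4F 0F = true
H2 0F 4F = true
H2 4F 1F = true
H2 1F 4F = true
H2 4F _  = false
H2 _  4F = false
H2 0F 0F = false
H2 1F 1F = false
H2 2F 2F = false
H2 3F 3F = false
H2 _  _  = true

-- An edge colouring of K_n with k colours (values on the diagonal are irrelevant).
record Coloring (n k : ℕ) : Set where
  field
    col : Fin n → Fin n → Fin k
    sym : ∀ i j → col i j ≡ col j i
open Coloring public

Gallai : ∀ {n k} → Coloring n k → Set
Gallai {n} c = ∀ (x y z : Fin n) → x ≢ y → y ≢ z → x ≢ z →
  ¬ (col c x y ≢ col c y z × col c y z ≢ col c x z × col c x y ≢ col c x z)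

HasMonoCopy : ∀ {n k m} → Coloring n k → Graph m → Fin k → Set
HasMonoCopy {n} {k} {m} c F i =
  Σ (Fin m → Fin n) λ f → Injective _≡_ _≡_ f ×
    (∀ a b → F a b ≡ true → col c (f a) (f b) ≡ i)

Family : ℕ → Set
Family k = Fin k → Σ ℕ Graph

Arrows : ∀ {k} → Family k → ℕ → Set
Arrows {k} F n = ∀ (c : Coloring n k) → Gallai c →
  ∃ λ (i : Fin k) → HasMonoCopy c (proj₂ (F i)) i


IsGR : ∀ {k} → Family k → ℕ → Set
IsGR F N = Arrows F N × (∀ m → m < N → ¬ Arrows F m)

data WhichH : Set where
  useH1 useH2 : WhichH

graphH : WhichH → Graph 5
graphH useH1 = H1
graphH useH2 = H2

-- F_1 = ... = F_r = H, F_{r+1} = ... = F_k = K_3 (colour index i is 0-based: i < r means H).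
mixedFamily : WhichH → (k r : ℕ) → Family k
mixedFamily w k r i = if toℕ i <ᵇ r then (5 , graphH w) else (3 , K3)

-- The claimed value, with s = k - r; cases on parities of s and r as in the paper.
grValue : (s r : ℕ) → ℕ
grValue s r with s % 2 | r % 2
... | 0 | 0 = 5 ^ (s / 2) * 17 ^ (r / 2) + 1
... | 1 | 0 = 2 * 5 ^ ((s ∸ 1) / 2) * 17 ^ (r / 2) + 1
... | 1 | 1 = 8 * 5 ^ ((s ∸ 1) / 2) * 17 ^ ((r ∸ 1) / 2) + 1
... | _ | _ = 4 * 5 ^ (s / 2) * 17 ^ ((r ∸ 1) / 2) + 1

{-# OPTIONS --safe #-}
module Submission where

{- Write s = k - r. The value is φ(s) ψ(r) + 1, where φ = 1, 2, 5, 10, ... gains a factor 5 and ψ = 1, 4, 17, 68, ...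
a factor 17 every two steps. Lower bound: substitute into each other one monochromatic K₄ (if r is odd, innermost),
two-coloured Paley graphs on 17 vertices, one edge (if s is odd) and two-coloured pentagons; every colour class is a
blow-up of, or a disjoint union of copies of, a class of one factor.

Upper bound: since H1 ⊆ H2 only H2 matters. By induction on |S|, a Gallai-coloured set S in which each colour i avoids
K₂, K₃ or H₂ has size at most φ(number of K₃-colours) ψ(number of H₂-colours). Among any three colours one is
disconnected, so S splits into at least two parts with only two colours a, b between parts and one colour between any
two of them. If some part sees the rest in one colour, S is a join. Otherwise every part has neighbours in both colours;
a K₄ in a or b meeting several parts, or a triangle inside a part, forces so much of the other colour that induction
suffices. If a part Z contains an edge of colour a or b, induction bounds Z and its a- and b-neighbourhoods separately.
If no part does, parts have size at most the value for the remaining colours, and their number is bounded by the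
two-colour Ramsey numbers R(3,3) = 6, R(3,4) = 9, R(4,4) = 18. -}

open import Defs hiding (sym)
open import Data.Bool using (Bool; true; false; T; if_then_else_)
import Data.Bool.Properties as Bool
open import Data.Empty using (⊥; ⊥-elim)
open import Data.Fin using (Fin; zero; suc; toℕ; punchIn; remQuot; combine; inject≤)
open import Data.Fin.Patterns
open import Data.Fin.Properties using (any?; all?; _≟_; suc-injective; punchIn-injective; punchInᵢ≢i; combine-remQuot; inject≤-injective; toℕ-fromℕ<; pigeonhole)
open import Data.List using (List; []; _∷_; allFin; cartesianProduct)
open import Data.List.Membership.DecPropositional using () renaming (_∈?_ to mem-list)
open import Data.List.Membership.Propositional using () renaming (_∈_ to _∈ˡ_)
open import Data.List.Membership.Propositional.Properties using (∈-allFin; ∈-cartesianProduct⁺)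
open import Data.List.Relation.Unary.Any using (here; there)
open import Data.Nat using (ℕ; zero; suc; _+_; _*_; _∸_; _^_; _/_; _%_; _≤_; _<_; _≤?_; _<ᵇ_; ∣_-_∣; z≤n; s≤s)
open import Data.Nat.DivMod using (m*n%n≡0; m*n/n≡m; [m+kn]%n≡m%n; _mod_; m<n⇒m%n≡m)
open import Data.Nat.Properties hiding (_≟_; _≤?_; suc-injective)
open import Data.Nat.Tactic.RingSolver using (solve-∀)
open import Data.Product using (Σ; ∃; _×_; _,_; proj₁; proj₂)
open import Data.Sum using (_⊎_; inj₁; inj₂; [_,_]; swap)
open import Data.Unit using (⊤; tt)
open import Data.Vec.Functional using (updateAt) renaming (_∷_ to _∷ᶠ_; [] to []ᶠ)
open import Data.Vec.Functional.Properties using (updateAt-updates; updateAt-minimal)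
open import Function using (_∘_; id)
open import Function.Definitions using (Injective)
open import Relation.Binary.Construct.Closure.Equivalence as EqC using (EqClosure)
open import Relation.Binary.PropositionalEquality using (_≡_; _≢_; refl; sym; trans; cong; cong₂; subst; ≢-sym; module ≡-Reasoning)
open import Relation.Binary.Structures using (IsEquivalence)
open import Relation.Nullary using (¬_; Dec; yes; no; contradiction)
open import Relation.Nullary.Decidable using (_×-dec_; _⊎-dec_; _→-dec_; ¬?; decidable-stable; map′; from-yes)
open import Algebra.Properties.CommutativeMonoid.Sum +-0-commutativeMonoid using (sum; sum-cong-≗; ∑-distrib-+)

-- Finite sums and sizes of decidable subsets

-- Forbidding H is almost forbidding K₄. A K₄ may occur in an H₂-free colour, but every further
-- vertex then sends at most one edge of that colour to it, so its other edges to the K₄ are forced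
-- into other colours. This is why the period of ψ is governed by 17 = R(4,4) - 1, while ψ(1) is 4
-- and not 3: one K₄ is allowed. It cannot be blown up, since H1 maps homomorphically onto K₄, so it
-- can be used only once. The mixed case is consistent because φ(1)ψ(1) = 8 = R(3,4) - 1. Passing to
-- a part or to a neighbourhood weakens individual colours: a colour may lose its K₄s, its triangles
-- or all its edges. The induction therefore runs over arbitrary assignments of types to colours,
-- with K₂ for an absent colour, and the two counts enter only through the value to be compared.

sum-mono : ∀ {n} {f g : Fin n → ℕ} → (∀ i → f i ≤ g i) → sum f ≤ sum g
sum-mono {zero}  f≤g = z≤n
sum-mono {suc n} f≤g = +-mono-≤ (f≤g zero) (sum-mono (f≤g ∘ suc))

term≤sum : ∀ {n} (f : Fin n → ℕ) i → f i ≤ sum f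
term≤sum f zero    = m≤m+n _ _
term≤sum f (suc i) = ≤-trans (term≤sum (f ∘ suc) i) (m≤n+m _ _)

-- Handshake lemma: the first row and the first column have equal sums, and what remains is a
-- smaller matrix of the same kind.
even-sum-sym : ∀ {n} (M : Fin n → Fin n → ℕ) → (∀ i → M i i ≡ 0) → (∀ i j → M i j ≡ M j i) →
  ∃ λ h → sum (λ i → sum (M i)) ≡ h + h
even-sum-sym {zero}  M irr sy = 0 , refl
even-sum-sym {suc n} M irr sy
  with h , eq ← even-sum-sym (λ i j → M (suc i) (suc j)) (irr ∘ suc) (λ i j → sy (suc i) (suc j)) = r + h , (begin
    M zero zero + r + sum (λ i → M (suc i) zero + sum (M (suc i) ∘ suc))
      ≡⟨ cong₂ (λ a b → a + r + b) (irr zero) (∑-distrib-+ (λ i → M (suc i) zero) _) ⟩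
    r + (sum (λ i → M (suc i) zero) + sum (λ i → sum (M (suc i) ∘ suc)))
      ≡⟨ cong₂ (λ a b → r + (a + b)) (sum-cong-≗ (λ i → sy (suc i) zero)) eq ⟩
    r + (r + (h + h)) ≡⟨ rearrange r h ⟩
    (r + h) + (r + h) ∎)
  where
  open ≡-Reasoning
  r = sum (M zero ∘ suc)
  rearrange : ∀ r h → r + (r + (h + h)) ≡ (r + h) + (r + h)
  rearrange = solve-∀

indicator : ∀ {A : Set} → Dec A → ℕ
indicator (yes _) = 1
indicator (no _)  = 0

indicator≤1 : ∀ {A : Set} (d : Dec A) → indicator d ≤ 1
indicator≤1 (yes _) = ≤-refl
indicator≤1 (no _)  = z≤n

indicator-⇔ : ∀ {A B : Set} (d : Dec A) (e : Dec B) → (A → B) → (B → A) → indicator d ≡ indicator e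
indicator-⇔ (yes a) (yes b) f g = refl
indicator-⇔ (yes a) (no ¬b) f g = contradiction (f a) ¬b
indicator-⇔ (no ¬a) (yes b) f g = contradiction (g b) ¬a
indicator-⇔ (no ¬a) (no ¬b) f g = refl

-- Subsets carry their decision procedure: it defines `size` and makes the case distinctions of the
-- argument constructive.
record Sub (n : ℕ) : Set₁ where
  field
    Mem  : Fin n → Set
    mem? : ∀ x → Dec (Mem x)
open Sub

infix 4 _∈_ _∈?_ _⊆_

_∈_ : ∀ {n} → Fin n → Sub n → Set
x ∈ S = Mem S x

_∈?_ : ∀ {n} (x : Fin n) (S : Sub n) → Dec (x ∈ S)
x ∈? S = mem? S x

_⊆_ : ∀ {n} → Sub n → Sub n → Set
A ⊆ B = ∀ x → x ∈ A → x ∈ B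

restrict : ∀ {n} (S : Sub n) {Q : Fin n → Set} → (∀ x → Dec (Q x)) → Sub n
restrict S {Q} Q? = record { Mem = λ x → x ∈ S × Q x ; mem? = λ x → (x ∈? S) ×-dec Q? x }

infixl 6 _∪_ _∖_

_∪_ : ∀ {n} → Sub n → Sub n → Sub n
A ∪ B = record { Mem = λ x → x ∈ A ⊎ x ∈ B ; mem? = λ x → (x ∈? A) ⊎-dec (x ∈? B) }

_∖_ : ∀ {n} → Sub n → Sub n → Sub n
A ∖ B = restrict A (λ x → ¬? (x ∈? B))

｛_｝ : ∀ {n} → Fin n → Sub n
｛ v ｝ = record { Mem = _≡ v ; mem? = _≟ v }

size : ∀ {n} → Sub n → ℕ
size S = sum (λ x → indicator (x ∈? S))

nonempty? : ∀ {n} (S : Sub n) → Dec (∃ λ x → x ∈ S)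
nonempty? S = any? (_∈? S)

module _ {n : ℕ} where

  size-cover : (S A B : Sub n) → (∀ x → x ∈ S → x ∈ A ⊎ x ∈ B) → size S ≤ size A + size B
  size-cover S A B cov = ≤-trans (sum-mono pointwise) (≤-reflexive (∑-distrib-+ (λ x → indicator (x ∈? A)) (λ x → indicator (x ∈? B))))
    where
    pointwise : ∀ x → indicator (x ∈? S) ≤ indicator (x ∈? A) + indicator (x ∈? B)
    pointwise x with x ∈? S | x ∈? A | x ∈? B
    ... | no _  | _     | _     = z≤n
    ... | yes _ | yes _ | _     = s≤s z≤n
    ... | yes _ | no _  | yes _ = s≤s z≤n
    ... | yes s | no ¬a | no ¬b with cov x s
    ...   | inj₁ a = contradiction a ¬a
    ...   | inj₂ b = contradiction b ¬b

  size-disjoint : (S A B : Sub n) → A ⊆ S → B ⊆ S → (∀ x → x ∈ A → ¬ x ∈ B) → size A + size B ≤ size S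
  size-disjoint S A B A⊆ B⊆ dis = ≤-trans (≤-reflexive (sym (∑-distrib-+ (λ x → indicator (x ∈? A)) (λ x → indicator (x ∈? B))))) (sum-mono pointwise)
    where
    pointwise : ∀ x → indicator (x ∈? A) + indicator (x ∈? B) ≤ indicator (x ∈? S)
    pointwise x with x ∈? S | x ∈? A | x ∈? B
    ... | _     | yes a | yes b = contradiction b (dis x a)
    ... | yes _ | yes _ | no _  = s≤s z≤n
    ... | yes _ | no _  | yes _ = s≤s z≤n
    ... | _     | no _  | no _  = z≤n
    ... | no ¬s | yes a | no _  = contradiction (A⊆ x a) ¬s
    ... | no ¬s | no _  | yes b = contradiction (B⊆ x b) ¬s

  size-mono : (A B : Sub n) → A ⊆ B → size A ≤ size B
  size-mono A B A⊆B = sum-mono pointwise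
    where
    pointwise : ∀ x → indicator (x ∈? A) ≤ indicator (x ∈? B)
    pointwise x with x ∈? A | x ∈? B
    ... | no _  | _     = z≤n
    ... | yes _ | yes _ = ≤-refl
    ... | yes a | no ¬b = contradiction (A⊆B x a) ¬b

  size-pos : (S : Sub n) → ∀ {v} → v ∈ S → 1 ≤ size S
  size-pos S {v} v∈ = ≤-trans (one (v ∈? S)) (term≤sum (λ x → indicator (x ∈? S)) v)
    where
    one : (d : Dec (v ∈ S)) → 1 ≤ indicator d
    one (yes _) = ≤-refl
    one (no ¬v) = contradiction v∈ ¬v

size-full : ∀ {n} (S : Sub n) → (∀ x → x ∈ S) → size S ≡ n
size-full {zero}  S all = refl
size-full {suc n} S all with zero ∈? S
... | yes _ = cong suc (size-full (record { mem? = λ x → suc x ∈? S }) (all ∘ suc))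
... | no ¬z = contradiction (all zero) ¬z

size-empty : ∀ {n} (S : Sub n) → (∀ x → ¬ x ∈ S) → size S ≡ 0
size-empty {zero}  S none = refl
size-empty {suc n} S none with zero ∈? S
... | yes z = contradiction z (none zero)
... | no _  = size-empty (record { mem? = λ x → suc x ∈? S }) (none ∘ suc)

size-singleton : ∀ {n} (S : Sub n) v → (∀ x → x ∈ S → x ≡ v) → size S ≤ 1
size-singleton {suc n} S zero sing =
  +-mono-≤ (indicator≤1 (zero ∈? S)) (≤-reflexive (size-empty (record { mem? = λ x → suc x ∈? S }) λ x x∈ → suc≢0 (sing (suc x) x∈)))
  where
  suc≢0 : ∀ {x : Fin n} → suc x ≢ zero
  suc≢0 ()
size-singleton {suc n} S (suc v) sing with zero ∈? S
... | yes z with () ← sing zero z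
... | no _  = size-singleton (record { mem? = λ x → suc x ∈? S }) v (λ x x∈ → suc-injective (sing (suc x) x∈))

module _ {n : ℕ} where

  size-insert : (S A : Sub n) → ∀ {v} → A ⊆ S → v ∈ S → ¬ v ∈ A → suc (size A) ≤ size S
  size-insert S A {v} A⊆ v∈ v∉ = ≤-trans
    (≤-trans (≤-reflexive (+-comm 1 _)) (+-monoʳ-≤ (size A) (size-pos ｛ v ｝ refl)))
    (size-disjoint S A ｛ v ｝ A⊆ (λ { _ refl → v∈ }) (λ { _ a refl → v∉ a }))

  size-delete : (S : Sub n) → ∀ v → size S ≤ suc (size (S ∖ ｛ v ｝))
  size-delete S v = ≤-trans (size-cover S ｛ v ｝ (S ∖ ｛ v ｝) split) (+-monoˡ-≤ _ (size-singleton ｛ v ｝ v λ _ → id))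
    where
    split : ∀ x → x ∈ S → x ∈ ｛ v ｝ ⊎ x ∈ S ∖ ｛ v ｝
    split x x∈ with x ≟ v
    ... | yes p = inj₁ p
    ... | no  p = inj₂ (x∈ , p)

  -- Used with `h` the map to representatives: at most `m` parts, each of size at most `u`. Each
  -- round discards one whole fibre and its value in `R`.
  size-fibres : ∀ m (P R : Sub n) (h : Fin n → Fin n) u → size R ≤ m → (∀ x → x ∈ P → h x ∈ R) →
    (∀ z → size (restrict P (λ x → h x ≟ z)) ≤ u) → size P ≤ m * u
  size-fibres m P R h u R≤ h∈ fib with nonempty? P
  ... | no empty = ≤-trans (≤-reflexive (size-empty P λ x x∈ → empty (x , x∈))) z≤n
  size-fibres zero P R h u R≤ h∈ fib | yes (x , x∈) = contradiction (≤-trans (size-pos R (h∈ x x∈)) R≤) λ ()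
  size-fibres (suc m) P R h u R≤ h∈ fib | yes (x , x∈) = ≤-trans
    (size-cover P fibre rest cover)
    (+-mono-≤ (fib (h x)) (size-fibres m rest (R ∖ ｛ h x ｝) h u R'≤ (λ y (y∈ , ne) → h∈ y y∈ , ne)
      (λ z → ≤-trans (size-mono _ (restrict P (λ x → h x ≟ z)) (λ y ((y∈ , _) , e) → y∈ , e)) (fib z))))
    where
    fibre = restrict P (λ y → h y ≟ h x)
    rest = restrict P (λ y → ¬? (h y ≟ h x))
    cover : ∀ y → y ∈ P → y ∈ fibre ⊎ y ∈ rest
    cover y y∈ with h y ≟ h x
    ... | yes p = inj₁ (y∈ , p)
    ... | no  p = inj₂ (y∈ , p)
    R'≤ : size (R ∖ ｛ h x ｝) ≤ m
    R'≤ = ≤-pred (≤-trans (size-insert R (R ∖ ｛ h x ｝) (λ _ → proj₁) (h∈ x x∈) (λ z → proj₂ z refl)) R≤)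

-- The extremal function

φ ψ : ℕ → ℕ
φ 0 = 1
φ 1 = 2
φ (suc (suc s)) = 5 * φ s
ψ 0 = 1
ψ 1 = 4
ψ (suc (suc r)) = 17 * ψ r

-- The parameters d, e (here) and f, g (below) turn every inequality between products of consecutive values of
-- φ and ψ into a coefficientwise comparison of polynomials over ℕ.
φ-growth : ∀ s → ∃ λ d → ∃ λ e → φ s ≡ 2 * d + e × φ (suc s) ≡ 5 * d + 2 * e
φ-growth zero = 0 , 1 , refl , refl
φ-growth (suc s) with d , e , p , q ← φ-growth s = e , 5 * d , trans q (+-comm (5 * d) (2 * e)) , trans (cong (5 *_) p) (identity d e)
  where
  identity : ∀ d e → 5 * (2 * d + e) ≡ 5 * e + 2 * (5 * d)
  identity = solve-∀

ψ-growth : ∀ r → ∃ λ f → ∃ λ g → ψ r ≡ 4 * f + g × ψ (suc r) ≡ 17 * f + 4 * g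
ψ-growth zero = 0 , 1 , refl , refl
ψ-growth (suc r) with f , g , p , q ← ψ-growth r = g , 17 * f , trans q (+-comm (17 * f) (4 * g)) , trans (cong (17 *_) p) (identity f g)
  where
  identity : ∀ f g → 17 * (4 * f + g) ≡ 17 * g + 4 * (17 * f)
  identity = solve-∀

φ-pos : ∀ s → 1 ≤ φ s
φ-pos 0 = s≤s z≤n
φ-pos 1 = s≤s z≤n
φ-pos (suc (suc s)) = ≤-trans (φ-pos s) (m≤n*m (φ s) 5)

ψ-pos : ∀ r → 1 ≤ ψ r
ψ-pos 0 = s≤s z≤n
ψ-pos 1 = s≤s z≤n
ψ-pos (suc (suc r)) = ≤-trans (ψ-pos r) (m≤n*m (ψ r) 17)

by-slack : ∀ {m n} d → n ≡ m + d → m ≤ n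
by-slack {m} d eq = ≤-trans (m≤m+n m d) (≤-reflexive (sym eq))

-- `s` and `r` count the `K₃`- and `H₂`-colours other than the one or two under discussion. Each
-- inequality closes the case in its name.
module Growth (s r : ℕ) where

  x y z w : ℕ
  x = φ s * ψ r
  y = φ (suc s) * ψ r
  z = φ s * ψ (suc r)
  w = φ (suc s) * ψ (suc r)

  x-pos : 1 ≤ x
  x-pos = *-mono-≤ (φ-pos s) (ψ-pos r)

  K₃-join : x + x ≤ y
  K₃-join with d , e , p , p' ← φ-growth s | f , g , q , q' ← ψ-growth r rewrite p | p' | q =
    by-slack (4 * (d * f) + 1 * (d * g)) (identity d e f g)
    where
    identity : ∀ d e f g → ((5 * d + 2 * e) * (4 * f + g)) ≡ ((2 * d + e) * (4 * f + g)) + ((2 * d + e) * (4 * f + g)) + (4 * (d * f) + 1 * (d * g))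
    identity = solve-∀

  H₂-join : x + y ≤ z
  H₂-join with d , e , p , p' ← φ-growth s | f , g , q , q' ← ψ-growth r rewrite p | p' | q | q' =
    by-slack (6 * (d * f) + 1 * (d * g) + 5 * (e * f) + 1 * (e * g)) (identity d e f g)
    where
    identity : ∀ d e f g → ((2 * d + e) * (17 * f + 4 * g)) ≡ ((2 * d + e) * (4 * f + g)) + ((5 * d + 2 * e) * (4 * f + g)) + (6 * (d * f) + 1 * (d * g) + 5 * (e * f) + 1 * (e * g))
    identity = solve-∀

  star-slack : x + 2 * (3 * y) ≤ 4 * z
  star-slack with d , e , p , p' ← φ-growth s | f , g , q , q' ← ψ-growth r rewrite p | p' | q | q' =
    by-slack (8 * (d * f) + 16 * (e * f) + 3 * (e * g)) (identity d e f g)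
    where
    identity : ∀ d e f g → 4 * ((2 * d + e) * (17 * f + 4 * g)) ≡ ((2 * d + e) * (4 * f + g)) + 2 * (3 * ((5 * d + 2 * e) * (4 * f + g))) + (8 * (d * f) + 16 * (e * f) + 3 * (e * g))
    identity = solve-∀

  K₃H₂-clique : 4 * x + z ≤ w
  K₃H₂-clique with d , e , p , p' ← φ-growth s | f , g , q , q' ← ψ-growth r rewrite p | p' | q | q' =
    by-slack (19 * (d * f) + 4 * (d * g) + 1 * (e * f)) (identity d e f g)
    where
    identity : ∀ d e f g → ((5 * d + 2 * e) * (17 * f + 4 * g)) ≡ 4 * ((2 * d + e) * (4 * f + g)) + ((2 * d + e) * (17 * f + 4 * g)) + (19 * (d * f) + 4 * (d * g) + 1 * (e * f))
    identity = solve-∀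

  K₃H₂-triangle : z + z ≤ w
  K₃H₂-triangle with d , e , p , p' ← φ-growth s | f , g , q , q' ← ψ-growth r rewrite p | p' | q' =
    by-slack (17 * (d * f) + 4 * (d * g)) (identity d e f g)
    where
    identity : ∀ d e f g → ((5 * d + 2 * e) * (17 * f + 4 * g)) ≡ ((2 * d + e) * (17 * f + 4 * g)) + ((2 * d + e) * (17 * f + 4 * g)) + (17 * (d * f) + 4 * (d * g))
    identity = solve-∀

  K₃H₂-edge : y + (z + y) ≤ w
  K₃H₂-edge with d , e , p , p' ← φ-growth s | f , g , q , q' ← ψ-growth r rewrite p | p' | q | q' =
    by-slack (11 * (d * f) + 2 * (d * g) + 1 * (e * f)) (identity d e f g)
    where
    identity : ∀ d e f g → ((5 * d + 2 * e) * (17 * f + 4 * g)) ≡ ((5 * d + 2 * e) * (4 * f + g)) + (((2 * d + e) * (17 * f + 4 * g)) + ((5 * d + 2 * e) * (4 * f + g))) + (11 * (d * f) + 2 * (d * g) + 1 * (e * f))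
    identity = solve-∀

  K₃H₂-ramsey : 8 * x ≤ w
  K₃H₂-ramsey with d , e , p , p' ← φ-growth s | f , g , q , q' ← ψ-growth r rewrite p | p' | q | q' =
    by-slack (21 * (d * f) + 4 * (d * g) + 2 * (e * f)) (identity d e f g)
    where
    identity : ∀ d e f g → ((5 * d + 2 * e) * (17 * f + 4 * g)) ≡ 8 * ((2 * d + e) * (4 * f + g)) + (21 * (d * f) + 4 * (d * g) + 2 * (e * f))
    identity = solve-∀

  H₂H₂-clique : 4 * x + w ≤ φ s * ψ (2 + r)
  H₂H₂-clique with d , e , p , p' ← φ-growth s | f , g , q , q' ← ψ-growth r rewrite p | p' | q | q' =
    by-slack (19 * (d * f) + 6 * (d * g) + 18 * (e * f) + 5 * (e * g)) (identity d e f g)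
    where
    identity : ∀ d e f g → ((2 * d + e) * (17 * (4 * f + g))) ≡ 4 * ((2 * d + e) * (4 * f + g)) + ((5 * d + 2 * e) * (17 * f + 4 * g)) + (19 * (d * f) + 6 * (d * g) + 18 * (e * f) + 5 * (e * g))
    identity = solve-∀

  H₂H₂-triangle : z + w ≤ φ s * ψ (2 + r)
  H₂H₂-triangle with d , e , p , p' ← φ-growth s | f , g , q , q' ← ψ-growth r rewrite p | p' | q | q' =
    by-slack (17 * (d * f) + 6 * (d * g) + 17 * (e * f) + 5 * (e * g)) (identity d e f g)
    where
    identity : ∀ d e f g → ((2 * d + e) * (17 * (4 * f + g))) ≡ ((2 * d + e) * (17 * f + 4 * g)) + ((5 * d + 2 * e) * (17 * f + 4 * g)) + (17 * (d * f) + 6 * (d * g) + 17 * (e * f) + 5 * (e * g))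
    identity = solve-∀

  H₂H₂-two-edges : φ (2 + s) * ψ r + (z + z) ≤ φ s * ψ (2 + r)
  H₂H₂-two-edges with d , e , p , p' ← φ-growth s | f , g , q , q' ← ψ-growth r rewrite p | q | q' =
    by-slack (28 * (d * f) + 8 * (d * g) + 14 * (e * f) + 4 * (e * g)) (identity d e f g)
    where
    identity : ∀ d e f g → ((2 * d + e) * (17 * (4 * f + g))) ≡ (5 * (2 * d + e) * (4 * f + g)) + (((2 * d + e) * (17 * f + 4 * g)) + ((2 * d + e) * (17 * f + 4 * g))) + (28 * (d * f) + 8 * (d * g) + 14 * (e * f) + 4 * (e * g))
    identity = solve-∀

  H₂H₂-edge : y + ((x + y) + w) ≤ φ s * ψ (2 + r)
  H₂H₂-edge with d , e , p , p' ← φ-growth s | f , g , q , q' ← ψ-growth r rewrite p | p' | q | q' =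
    by-slack (3 * (d * f) + 2 * (d * g) + 14 * (e * f) + 4 * (e * g)) (identity d e f g)
    where
    identity : ∀ d e f g → ((2 * d + e) * (17 * (4 * f + g))) ≡ ((5 * d + 2 * e) * (4 * f + g)) + ((((2 * d + e) * (4 * f + g)) + ((5 * d + 2 * e) * (4 * f + g))) + ((5 * d + 2 * e) * (17 * f + 4 * g))) + (3 * (d * f) + 2 * (d * g) + 14 * (e * f) + 4 * (e * g))
    identity = solve-∀

  four-blocks : 4 * x ≤ z
  four-blocks with d , e , p , p' ← φ-growth s | f , g , q , q' ← ψ-growth r rewrite p | q | q' =
    by-slack (2 * (d * f) + 1 * (e * f)) (identity d e f g)
    where
    identity : ∀ d e f g → (2 * d + e) * (17 * f + 4 * g) ≡ 4 * ((2 * d + e) * (4 * f + g)) + (2 * (d * f) + 1 * (e * f))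
    identity = solve-∀

  4≤4x : 4 ≤ 4 * x
  4≤4x = *-monoʳ-≤ 4 x-pos

  -- Integrality matters: over the rationals 3y/2 + 1 ≤ z fails at s = 1, r = 0, where y = 5 and z =
  -- 8. By `star-slack` only 3y/2 < z holds, and the integer m then lies below z.
  star : ∀ {m} → 2 * m ≤ 3 * y → suc m ≤ z
  star {m} le = *-cancelˡ-< 4 m z (begin
    suc (4 * m)           ≡⟨ cong suc (*-assoc 2 2 m) ⟩
    1 + 2 * (2 * m)       ≤⟨ +-mono-≤ x-pos (*-monoʳ-≤ 2 le) ⟩
    x + 2 * (3 * y)       ≤⟨ star-slack ⟩
    4 * z                 ∎)
    where open ≤-Reasoning

-- Forbidden subgraphs and types of colours

-- `K₂` marks a colour that is absent. In the induction a type stays or moves down in the order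
-- `H₂`, `K₃`, `K₂`.
data Ty : Set where
  K₂ K₃ H₂ : Ty

isK₃ isH₂ : Ty → ℕ
isK₃ K₃ = 1
isK₃ _        = 0
isH₂ H₂ = 1
isH₂ _    = 0

extremal : ∀ {k} → (Fin k → Ty) → ℕ
extremal t = φ (sum (isK₃ ∘ t)) * ψ (sum (isH₂ ∘ t))

_[_≔_] : ∀ {k} → (Fin k → Ty) → Fin k → Ty → Fin k → Ty
t [ i ≔ σ ] = updateAt t i (λ _ → σ)

sum-set : ∀ {k} (h : Ty → ℕ) (t : Fin k → Ty) i σ → h (t i) ≡ 0 → sum (h ∘ t [ i ≔ σ ]) ≡ h σ + sum (h ∘ t)
sum-set h t zero    σ e rewrite e = refl
sum-set h t (suc i) σ e = trans (cong (h (t zero) +_) (sum-set h (t ∘ suc) i σ e)) (exchange (h (t zero)) (h σ) _)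
  where
  exchange : ∀ a b c → a + (b + c) ≡ b + (a + c)
  exchange = solve-∀

extremal-set : ∀ {k} (t : Fin k → Ty) i σ → t i ≡ K₂ →
  extremal (t [ i ≔ σ ]) ≡ φ (isK₃ σ + sum (isK₃ ∘ t)) * ψ (isH₂ σ + sum (isH₂ ∘ t))
extremal-set t i σ e = cong₂ (λ m n → φ m * ψ n) (sum-set isK₃ t i σ (cong isK₃ e)) (sum-set isH₂ t i σ (cong isH₂ e))

extremal-cong : ∀ {k} {t u : Fin k → Ty} → (∀ j → t j ≡ u j) → extremal t ≡ extremal u
extremal-cong e = cong₂ (λ m n → φ m * ψ n) (sum-cong-≗ (cong isK₃ ∘ e)) (sum-cong-≗ (cong isH₂ ∘ e))

fresh : ∀ (e₁ e₂ e₃ : Fin 4) → ∃ λ m → m ≢ e₁ × m ≢ e₂ × m ≢ e₃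
fresh = from-yes (all? {n = 4} λ e₁ → all? {n = 4} λ e₂ → all? {n = 4} λ e₃ → any? {n = 4} λ m → ¬? (m ≟ e₁) ×-dec ¬? (m ≟ e₂) ×-dec ¬? (m ≟ e₃))

pigeonhole₃ : ∀ {n} {x : Fin 3 → Fin n} {u v} → (∀ {m m'} → m ≢ m' → x m ≢ x m') → ∃ λ m → x m ≢ u × x m ≢ v
pigeonhole₃ {x = x} {u} {v} distinct = decidable-stable (any? λ m → ¬? (x m ≟ u) ×-dec ¬? (x m ≟ v))
  (λ none → collide none (x 0F ≟ u) (x 1F ≟ u) (x 2F ≟ u))
  where
  same : ∀ {m m' w} → x m ≡ w → x m' ≡ w → m ≡ m'
  same {m} {m'} p q = decidable-stable (m ≟ m') (λ ne → distinct ne (trans p (sym q)))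
  collide : ¬ (∃ λ m → x m ≢ u × x m ≢ v) → Dec (x 0F ≡ u) → Dec (x 1F ≡ u) → Dec (x 2F ≡ u) → ⊥
  collide none d₀ d₁ d₂ = two d₀ d₁ d₂
    where
    other : ∀ {m} → x m ≢ u → x m ≡ v
    other {m} p = decidable-stable (x m ≟ v) (λ q → none (m , p , q))
    -- Two of the three answers agree, and then two of the points coincide, at `u` or at `v`.
    two : Dec (x 0F ≡ u) → Dec (x 1F ≡ u) → Dec (x 2F ≡ u) → ⊥
    two (yes p) (yes q) _       with () ← same p q
    two (yes p) _       (yes r) with () ← same p r
    two _       (yes q) (yes r) with () ← same q r
    two (no p)  (no q)  _       with () ← same (other p) (other q)
    two (no p)  _       (no r)  with () ← same (other p) (other r)
    two _       (no q)  (no r)  with () ← same (other q) (other r)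

-- Connected components and the Gallai partition

module _ {n : ℕ} (R : Fin n → Fin n → Set) (R? : ∀ x y → Dec (R x y)) where

  -- Union-find over a list of pairs: a related pair redirects the representative of `a` to that of
  -- `b`, so the classes are the fibres of an idempotent map. The `EqClosure` clause keeps the chain
  -- behind each identification, along which properties are transported later.
  components-on : (ps : List (Fin n × Fin n)) → ∃ λ (rep : Fin n → Fin n) →
    (∀ x → rep (rep x) ≡ rep x) ×
    (∀ {x y} → rep x ≡ rep y → EqClosure R x y) ×
    (∀ {x y} → (x , y) ∈ˡ ps → R x y → rep x ≡ rep y)
  components-on [] = id , (λ _ → refl) , (λ { refl → EqC.reflexive R }) , λ ()
  components-on ((a , b) ∷ ps) with components-on ps | R? a b
  ... | rep , idem , conn , joined | no ¬r = rep , idem , conn , λ { (here refl) r → contradiction r ¬r ; (there p) r → joined p r }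
  ... | rep , idem , conn , joined | yes r = rep' , idem' , (λ {x} {y} → conn' x y) , joined'
    where
    merge : Fin n → Fin n
    merge z with z ≟ rep a
    ... | yes _ = rep b
    ... | no  _ = z
    rep' = merge ∘ rep
    merge-b : merge (rep b) ≡ rep b
    merge-b with rep b ≟ rep a
    ... | yes _ = refl
    ... | no  _ = refl
    merge-a : merge (rep a) ≡ rep b
    merge-a with rep a ≟ rep a
    ... | yes _ = refl
    ... | no  p = contradiction refl p
    merge-other : ∀ z → z ≢ rep a → merge z ≡ z
    merge-other z p with z ≟ rep a
    ... | yes q = contradiction q p
    ... | no  _ = refl
    idem' : ∀ x → rep' (rep' x) ≡ rep' x
    idem' x with rep x ≟ rep a
    ... | yes _ rewrite idem b = merge-b
    ... | no  p rewrite idem x = merge-other (rep x) p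
    conn' : ∀ x y → rep' x ≡ rep' y → EqClosure R x y
    conn' x y e with rep x ≟ rep a | rep y ≟ rep a
    ... | yes p | yes q = conn (trans p (sym q))
    ... | yes p | no  _ = EqC.transitive R (conn p) (EqC.transitive R (EqC.return r) (conn e))
    ... | no  _ | yes q = EqC.transitive R (conn e) (EqC.transitive R (EqC.symmetric R (EqC.return r)) (conn (sym q)))
    ... | no  _ | no  _ = conn e
    joined' : ∀ {x y} → (x , y) ∈ˡ ((a , b) ∷ ps) → R x y → rep' x ≡ rep' y
    joined' (here refl) _ = trans merge-a (sym merge-b)
    joined' (there p) s = cong merge (joined p s)

  components : ∃ λ (rep : Fin n → Fin n) →
    (∀ x → rep (rep x) ≡ rep x) ×
    (∀ {x y} → rep x ≡ rep y → EqClosure R x y) ×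
    (∀ {x y} → R x y → rep x ≡ rep y)
  components with rep , idem , conn , joined ← components-on (cartesianProduct (allFin n) (allFin n))
    = rep , idem , conn , λ {x} {y} → joined (∈-cartesianProduct⁺ (∈-allFin x) (∈-allFin y))

module Colored {n k : ℕ} (c : Coloring n k) (gallai : Gallai c) where

  χ : Fin n → Fin n → Fin k
  χ = col c

  χ-sym : ∀ x y → χ x y ≡ χ y x
  χ-sym = Coloring.sym c

  third-edge : ∀ {x y z} → x ≢ y → y ≢ z → x ≢ z → χ x y ≢ χ x z → χ y z ≢ χ x y → χ y z ≡ χ x z
  third-edge {x} {y} {z} xy yz xz p q with χ y z ≟ χ x z
  ... | yes e = e
  ... | no ne = ⊥-elim (gallai x y z xy yz xz (≢-sym q , ne , p))

  -- The parts are the components of the graph of those edges of `S` whose colour is not `Ok`. The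
  -- Gallai condition enters through `const`. By `sep`, a set left only by `Ok` edges is a union of
  -- parts; this turns a cut into two points of different parts.
  record Quotient (S : Sub n) (Ok : Fin k → Set) : Set₁ where
    field
      rep   : Fin n → Fin n
      idem  : ∀ x → rep (rep x) ≡ rep x
      rep∈  : ∀ {x} → x ∈ S → rep x ∈ S
      cross : ∀ {x y} → x ∈ S → y ∈ S → rep x ≢ rep y → Ok (χ x y)
      const : ∀ {w x y} → w ∈ S → rep x ≡ rep y → rep w ≢ rep x → χ w x ≡ χ w y
      sep   : (A : Sub n) → (∀ {x y} → x ∈ S → y ∈ S → x ∈ A → ¬ y ∈ A → Ok (χ x y)) →
              ∀ {x y} → rep x ≡ rep y → x ∈ A → y ∈ A

  quotient : (S : Sub n) (Ok : Fin k → Set) → (∀ i → Dec (Ok i)) → Quotient S Ok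
  quotient S Ok Ok? = record
    { rep = rep ; idem = idem ; cross = cross
    ; rep∈ = λ {x} x∈ → proj₁ (invariant (_∈ S) (λ (x∈ , y∈ , _) → (λ _ → y∈) , (λ _ → x∈)) (sym (idem x))) x∈
    ; const = λ {w} {x} {y} w∈ e → proj₂ (EqC.fold (equiv w) (step w w∈) (conn {x} {y} e))
    ; sep = λ A cut e → proj₁ (invariant (_∈ A) (λ {x} {y} r → stay A cut r , stay A cut (flip r)) e)
    }
    where
    R : Fin n → Fin n → Set
    R x y = x ∈ S × y ∈ S × x ≢ y × ¬ Ok (χ x y)
    R? : ∀ x y → Dec (R x y)
    R? x y = (x ∈? S) ×-dec (y ∈? S) ×-dec ¬? (x ≟ y) ×-dec ¬? (Ok? (χ x y))
    flip : ∀ {x y} → R x y → R y x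
    flip {x} {y} (x∈ , y∈ , ne , bad) = y∈ , x∈ , ≢-sym ne , subst (¬_ ∘ Ok) (χ-sym x y) bad
    comps = components R R?
    rep = proj₁ comps
    idem = proj₁ (proj₂ comps)
    conn : ∀ {x y} → rep x ≡ rep y → EqClosure R x y
    conn = proj₁ (proj₂ (proj₂ comps))
    joined : ∀ {x y} → R x y → rep x ≡ rep y
    joined = proj₂ (proj₂ (proj₂ comps))
    invariant : (P : Fin n → Set) → (∀ {x y} → R x y → (P x → P y) × (P y → P x)) →
                ∀ {x y} → rep x ≡ rep y → (P x → P y) × (P y → P x)
    invariant P inv {x} {y} e = EqC.fold {S = λ x y → (P x → P y) × (P y → P x)} (record
      { refl = id , id ; sym = λ (f , g) → g , f ; trans = λ (f , g) (f' , g') → f' ∘ f , g ∘ g' }) inv (conn {x} {y} e)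
    cross : ∀ {x y} → x ∈ S → y ∈ S → rep x ≢ rep y → Ok (χ x y)
    cross {x} {y} x∈ y∈ ne with Ok? (χ x y)
    ... | yes ok = ok
    ... | no bad = contradiction (joined (x∈ , y∈ , (λ e → ne (cong rep e)) , bad)) ne
    stay : (A : Sub n) → (∀ {x y} → x ∈ S → y ∈ S → x ∈ A → ¬ y ∈ A → Ok (χ x y)) → ∀ {x y} → R x y → x ∈ A → y ∈ A
    stay A cut {x} {y} (x∈ , y∈ , _ , bad) xA with y ∈? A
    ... | yes yA = yA
    ... | no  y∉ = contradiction (cut x∈ y∈ xA y∉) bad
    -- Constancy of `χ w` is phrased as an equivalence relation containing `R`, so that it
    -- propagates along chains; the part of `w` itself is exempt.
    _~[_]_ : Fin n → Fin n → Fin n → Set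
    x ~[ w ] y = rep x ≡ rep y × (rep w ≢ rep x → χ w x ≡ χ w y)
    equiv : ∀ w → IsEquivalence (_~[ w ]_)
    equiv w = record
      { refl = refl , λ _ → refl
      ; sym = λ (e , f) → sym e , λ ne → sym (f (λ q → ne (trans q e)))
      ; trans = λ (e , f) (e' , f') → trans e e' , λ ne → trans (f ne) (f' (λ q → ne (trans q (sym e)))) }
    step : ∀ w → w ∈ S → ∀ {x y} → R x y → x ~[ w ] y
    step w w∈ {x} {y} r@(x∈ , y∈ , x≢y , bad) = joined r , edge
      where
      edge : rep w ≢ rep x → χ w x ≡ χ w y
      edge ne with χ w x ≟ χ w y
      ... | yes e = e
      -- If `w` saw `x` and `y` in different colours, the edge between them would repeat one of the
      -- two, and both are `Ok`.
      ... | no  d = contradiction okxy bad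
        where
        ne' : rep w ≢ rep y
        ne' q = ne (trans q (sym (joined r)))
        okxy : Ok (χ x y)
        okxy with χ x y ≟ χ w x
        ... | yes e = subst Ok (sym e) (cross w∈ x∈ ne)
        ... | no ne₂ = subst Ok (sym (third-edge (ne ∘ cong rep) x≢y (ne' ∘ cong rep) d ne₂)) (cross w∈ y∈ ne')

  -- For `Ok` equal to `_≢ i` a cut says that colour `i` is disconnected on `S`; for `OneOf L` it
  -- limits the colours across. The two named points make it proper.
  record Cut (S : Sub n) (Ok : Fin k → Set) : Set₁ where
    constructor mkCut
    field
      side     : Sub n
      {x₁ y₁}  : Fin n
      x₁∈      : x₁ ∈ S
      y₁∈      : y₁ ∈ S
      x₁∈side  : x₁ ∈ side
      y₁∉side  : ¬ y₁ ∈ side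
      crossing : ∀ {x y} → x ∈ S → y ∈ S → x ∈ side → ¬ y ∈ side → Ok (χ x y)

  vertex-cut : (S : Sub n) (Ok : Fin k → Set) {v y : Fin n} → v ∈ S → y ∈ S → y ≢ v →
    (∀ {x} → x ∈ S → x ≢ v → Ok (χ v x)) → Cut S Ok
  vertex-cut S Ok {v} v∈ y∈ y≢v ok = mkCut ｛ v ｝ v∈ y∈ refl y≢v (λ { x∈ y∈ refl y≢v → ok y∈ y≢v })

  -- If every i-component of S ∖ v has an i-neighbour of v, then a j-neighbour p of v is joined in colour j to
  -- every i-component other than its own, and likewise for l; this is contradictory.
  extend-cut : (S : Sub n) {v : Fin n} → v ∈ S → ∀ {i j l} → j ≢ i → l ≢ i → j ≢ l →
    Cut (S ∖ ｛ v ｝) (_≢ i) → Cut S (_≢ i) ⊎ Cut S (_≢ j) ⊎ Cut S (_≢ l)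
  extend-cut S {v} v∈ {i} {j} {l} j≢i l≢i j≢l (mkCut A {x₁} {y₁} x₁∈ y₁∈ x₁A y₁A crossing) = result
    where
    S' = S ∖ ｛ v ｝
    Q = quotient S' (_≢ i) (λ d → ¬? (d ≟ i))
    open Quotient Q
    isolated? = any? λ u → (u ∈? S') ×-dec all? (λ w → (w ∈? S') →-dec ((rep w ≟ rep u) →-dec ¬? (χ v w ≟ i)))
    neighbour? : ∀ d → Dec (∃ λ a → a ∈ S' × χ v a ≡ d)
    neighbour? d = any? λ a → (a ∈? S') ×-dec (χ v a ≟ d)
    forced : ∀ {p w d} → p ∈ S' → w ∈ S' → χ v p ≡ d → d ≢ i → χ v w ≡ i → rep p ≢ rep w → χ p w ≡ d
    forced {p} {w} {d} (p∈ , p≢v) (w∈ , w≢v) vp d≢i vw ne with χ p w ≟ d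
    ... | yes e = e
    ... | no  q = contradiction
      (trans (third-edge (≢-sym p≢v) (ne ∘ cong rep) (≢-sym w≢v) (λ e → d≢i (trans (sym vp) (trans e vw))) (λ e → q (trans e vp))) vw)
      (cross (p∈ , p≢v) (w∈ , w≢v) ne)
    outside : ∀ {a} → ∃ λ u → u ∈ S' × rep u ≢ rep a
    outside {a} with rep x₁ ≟ rep a
    ... | no  p = x₁ , x₁∈ , p
    ... | yes p = y₁ , y₁∈ , λ q → y₁A (sep A crossing (trans p (sym q)) x₁A)
    absurd : (∀ u → u ∈ S' → ∃ λ w → w ∈ S' × rep w ≡ rep u × χ v w ≡ i) →
      ∀ {a b} → a ∈ S' → b ∈ S' → χ v a ≡ j → χ v b ≡ l → ⊥
    absurd touch {a} {b} a∈ b∈ va vb with rep a ≟ rep b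
    -- If `a` and `b` share a component, a vertex `w` of another one with χ v w = i sees `a` in
    -- colour j and `b` in colour l, against `const`. If they do not, the edge between them would
    -- itself have both colours.
    ... | yes e with u , u∈ , ne ← outside {a} with w , w∈ , wu , vw ← touch u u∈ = j≢l
      (trans (sym (forced a∈ w∈ va j≢i vw (λ q → ne (trans (sym wu) (sym q)))))
      (trans (χ-sym a w)
      (trans (const w∈ e (λ q → ne (trans (sym wu) q)))
      (trans (χ-sym w b)
      (forced b∈ w∈ vb l≢i vw (λ q → ne (trans (sym wu) (trans (sym q) (sym e)))))))))
    ... | no ne with wa , wa∈ , ea , vwa ← touch a a∈ | wb , wb∈ , eb , vwb ← touch b b∈ = j≢l
      (trans (sym (trans (sym (const a∈ eb (λ q → ne (trans q eb)))) (forced a∈ wb∈ va j≢i vwb (λ q → ne (trans q eb)))))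
      (trans (χ-sym a b)
      (trans (sym (const b∈ ea (λ q → ne (trans (sym ea) (sym q))))) (forced b∈ wa∈ vb l≢i vwa (λ q → ne (trans (sym ea) (sym q)))))))
    result : Cut S (_≢ i) ⊎ Cut S (_≢ j) ⊎ Cut S (_≢ l)
    result with isolated?
    ... | yes (u , u∈ , iso) = inj₁ (mkCut (restrict S' (λ w → rep w ≟ rep u)) (proj₁ u∈) v∈ (u∈ , refl) (λ z → proj₂ (proj₁ z) refl) cr)
      where
      cr : ∀ {x y} → x ∈ S → y ∈ S → (x ∈ S' × rep x ≡ rep u) → ¬ (y ∈ S' × rep y ≡ rep u) → χ x y ≢ i
      cr {x} {y} x∈ y∈ (x∈' , e) y∉ with y ≟ v
      ... | yes refl = λ q → iso x x∈' e (trans (χ-sym v x) q)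
      ... | no  y≢v = cross x∈' (y∈ , y≢v) (λ q → y∉ ((y∈ , y≢v) , trans (sym q) e))
    ... | no ¬iso with neighbour? j | neighbour? l
    ...   | no ¬j | _ = inj₂ (inj₁ (vertex-cut S _ v∈ (proj₁ x₁∈) (proj₂ x₁∈) (λ x∈ x≢v e → ¬j (_ , (x∈ , x≢v) , e))))
    ...   | _ | no ¬l = inj₂ (inj₂ (vertex-cut S _ v∈ (proj₁ x₁∈) (proj₂ x₁∈) (λ x∈ x≢v e → ¬l (_ , (x∈ , x≢v) , e))))
    ...   | yes (a , a∈ , va) | yes (b , b∈ , vb) = ⊥-elim (absurd touch a∈ b∈ va vb)
      where
      touch : ∀ u → u ∈ S' → ∃ λ w → w ∈ S' × rep w ≡ rep u × χ v w ≡ i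
      touch u u∈ = decidable-stable (any? λ w → (w ∈? S') ×-dec (rep w ≟ rep u) ×-dec (χ v w ≟ i))
        (λ none → ¬iso (u , u∈ , λ w w∈ e q → none (w , w∈ , e , q)))

  -- Delete `x`; then `extend-cut` lifts the cut of the rest, possibly for another of the three
  -- colours. On two vertices the single edge misses at least two of the colours.
  disconnected-colour : ∀ m (S : Sub n) → size S ≤ m → ∀ {x y} → x ∈ S → y ∈ S → x ≢ y →
    ∀ {i j l} → i ≢ j → i ≢ l → j ≢ l → Cut S (_≢ i) ⊎ Cut S (_≢ j) ⊎ Cut S (_≢ l)
  disconnected-colour zero S S≤ x∈ y∈ x≢y i≢j i≢l j≢l = contradiction (≤-trans (size-pos S x∈) S≤) λ ()
  disconnected-colour (suc m) S S≤ {x} {y} x∈ y∈ x≢y {i} {j} {l} i≢j i≢l j≢l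
    with any? (λ z → (z ∈? S) ×-dec ¬? (z ≟ x) ×-dec ¬? (z ≟ y))
  ... | yes (z , z∈ , z≢x , z≢y)
    with disconnected-colour m (S ∖ ｛ x ｝) (≤-pred (≤-trans (size-insert S (S ∖ ｛ x ｝) (λ _ → proj₁) x∈ (λ p → proj₂ p refl)) S≤))
           (y∈ , ≢-sym x≢y) (z∈ , z≢x) (≢-sym z≢y) i≢j i≢l j≢l
  ...   | inj₁ cut = extend-cut S x∈ (≢-sym i≢j) (≢-sym i≢l) j≢l cut
  ...   | inj₂ (inj₁ cut) with extend-cut S x∈ i≢j (≢-sym j≢l) i≢l cut
  ...     | inj₁ r = inj₂ (inj₁ r)
  ...     | inj₂ (inj₁ r) = inj₁ r
  ...     | inj₂ (inj₂ r) = inj₂ (inj₂ r)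
  disconnected-colour (suc m) S S≤ {x} {y} x∈ y∈ x≢y {i} {j} {l} i≢j i≢l j≢l | yes _ | inj₂ (inj₂ cut)
    with extend-cut S x∈ i≢l j≢l i≢j cut
  ...     | inj₁ r = inj₂ (inj₂ r)
  ...     | inj₂ (inj₁ r) = inj₁ r
  ...     | inj₂ (inj₂ r) = inj₂ (inj₁ r)
  disconnected-colour (suc m) S S≤ {x} {y} x∈ y∈ x≢y {i} {j} {l} i≢j i≢l j≢l | no pair with χ x y ≟ i
  ... | no  xy≢i = inj₁ (vertex-cut S _ x∈ y∈ (≢-sym x≢y) only)
    where
    only : ∀ {z} → z ∈ S → z ≢ x → χ x z ≢ i
    only {z} z∈ z≢x with z ≟ y
    ... | yes refl = xy≢i
    ... | no z≢y = contradiction (z , z∈ , z≢x , z≢y) pair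
  ... | yes xy≡i = inj₂ (inj₁ (vertex-cut S _ x∈ y∈ (≢-sym x≢y) only))
    where
    only : ∀ {z} → z ∈ S → z ≢ x → χ x z ≢ j
    only {z} z∈ z≢x with z ≟ y
    ... | yes refl = λ e → i≢j (trans (sym xy≡i) e)
    ... | no z≢y = contradiction (z , z∈ , z≢x , z≢y) pair

  OneOf : List (Fin k) → Fin k → Set
  OneOf L i = i ∈ˡ L

  oneOf? : ∀ L i → Dec (OneOf L i)
  oneOf? L i = mem-list _≟_ i L

  weaken-cut : ∀ {S Ok Ok'} → (∀ {i} → Ok i → Ok' i) → Cut S Ok → Cut S Ok'
  weaken-cut f (mkCut A x∈ y∈ xA yA cr) = mkCut A x∈ y∈ xA yA (λ a b d e → f (cr a b d e))

  -- The new cut comes from a disconnected colour on representatives of the quotient.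
  drop-colour : ∀ {S a b d L} → a ≢ b → a ≢ d → b ≢ d → Cut S (OneOf L) →
    let Without e = λ i → OneOf L i × i ≢ e in Cut S (Without a) ⊎ Cut S (Without b) ⊎ Cut S (Without d)
  drop-colour {S} {a} {b} {d} {L} a≢b a≢d b≢d (mkCut A {x₁} {y₁} x₁∈ y₁∈ x₁A y₁A crossing)
    with disconnected-colour (size S°) S° ≤-refl (rep∈ x₁∈ , idem x₁) (rep∈ y₁∈ , idem y₁) rx≢ry a≢b a≢d b≢d
    where
    open Quotient (quotient S (OneOf L) (oneOf? L))
    S° = restrict S (λ x → rep x ≟ x)
    rx≢ry : rep x₁ ≢ rep y₁
    rx≢ry e = y₁A (sep A crossing e x₁A)
  ... | r = result r
    where
    open Quotient (quotient S (OneOf L) (oneOf? L))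
    S° = restrict S (λ x → rep x ≟ x)
    lift : ∀ {e} → Cut S° (_≢ e) → Cut S (λ i → OneOf L i × i ≢ e)
    lift {e} (mkCut B (x∈ , rx) (y∈ , ry) xB yB cr) =
      mkCut (record { Mem = λ x → rep x ∈ B ; mem? = λ x → rep x ∈? B }) x∈ y∈
        (subst (_∈ B) (sym rx) xB) (λ p → yB (subst (_∈ B) ry p)) cr'
      where
      cr' : ∀ {x y} → x ∈ S → y ∈ S → rep x ∈ B → ¬ rep y ∈ B → OneOf L (χ x y) × χ x y ≢ e
      cr' {x} {y} x∈ y∈ xB y∉ = cross x∈ y∈ ne , λ q →
        cr (rep∈ x∈ , idem x) (rep∈ y∈ , idem y) xB y∉ (trans (sym same) q)
        where
        ne : rep x ≢ rep y
        ne q = y∉ (subst (_∈ B) q xB)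
        same : χ x y ≡ χ (rep x) (rep y)
        same = trans (const x∈ (sym (idem y)) ne)
          (trans (χ-sym x (rep y)) (trans (const (rep∈ y∈) (sym (idem x)) (λ q → ne (sym (trans (sym (idem y)) q)))) (χ-sym (rep y) (rep x))))
    result : Cut S° (_≢ a) ⊎ Cut S° (_≢ b) ⊎ Cut S° (_≢ d) → _
    result (inj₁ r) = inj₁ (lift r)
    result (inj₂ (inj₁ r)) = inj₂ (inj₁ (lift r))
    result (inj₂ (inj₂ r)) = inj₂ (inj₂ (lift r))

  -- While the list starts with three distinct colours, `drop-colour` rules one of them out;
  -- repeated entries are deleted. The side of the cut may change in every round.
  two-coloured-cut : ∀ {S} a b L → Cut S (OneOf (a ∷ b ∷ L)) → ∃ λ a → ∃ λ b → Cut S (OneOf (a ∷ b ∷ []))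
  two-coloured-cut a b [] cut = a , b , cut
  two-coloured-cut a b (d ∷ L) cut with a ≟ b | a ≟ d | b ≟ d
  ... | yes refl | _ | _ = two-coloured-cut b d L (weaken-cut (λ { (here e) → here e ; (there p) → p }) cut)
  ... | no _ | yes refl | _ = two-coloured-cut a b L (weaken-cut (λ { (here e) → here e ; (there (here e)) → there (here e) ; (there (there (here e))) → here e ; (there (there (there p))) → there (there p) }) cut)
  ... | no _ | no _ | yes refl = two-coloured-cut a b L (weaken-cut (λ { (here e) → here e ; (there (here e)) → there (here e) ; (there (there (here e))) → there (here e) ; (there (there (there p))) → there (there p) }) cut)
  ... | no a≢b | no a≢d | no b≢d with drop-colour a≢b a≢d b≢d cut
  ...   | inj₁ cut' = two-coloured-cut b d L (weaken-cut (λ { (here e , ne) → contradiction e ne ; (there p , _) → p }) cut')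
  ...   | inj₂ (inj₁ cut') = two-coloured-cut a d L (weaken-cut (λ { (here e , ne) → here e ; (there (here e) , ne) → contradiction e ne ; (there (there p) , _) → there p }) cut')
  ...   | inj₂ (inj₂ cut') = two-coloured-cut a b L (weaken-cut (λ { (here e , ne) → here e ; (there (here e) , _) → there (here e) ; (there (there (here e)) , ne) → contradiction e ne ; (there (there (there p)) , _) → there (there p) }) cut')

  gallai-partition : ∀ (S : Sub n) {x y} → x ∈ S → y ∈ S → x ≢ y →
    ∃ λ a → ∃ λ b → Σ (Quotient S (OneOf (a ∷ b ∷ []))) λ Q → ∃ λ x → ∃ λ y → x ∈ S × y ∈ S × Quotient.rep Q x ≢ Quotient.rep Q y
  gallai-partition S {x} {y} x∈ y∈ x≢y
    with a , b , mkCut A {x₁} {y₁} x₁∈ y₁∈ x₁A y₁A crossing ←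
      -- All colours are allowed at the start; the two copies of `χ x y` only give the list its
      -- required shape.
      two-coloured-cut (χ x y) (χ x y) (allFin k) (vertex-cut S _ x∈ y∈ (≢-sym x≢y) (λ _ _ → there (there (∈-allFin _))))
    = a , b , Q , x₁ , y₁ , x₁∈ , y₁∈ , λ e → y₁A (Quotient.sep Q A crossing e x₁A)
    where
    Q = quotient S (OneOf (a ∷ b ∷ [])) (oneOf? _)

  -- Monochromatic cliques

  -- Diagonal values of a colouring are arbitrary, so an edge carries distinctness; cliques are
  -- thereby injective.
  E : Fin k → Fin n → Fin n → Set
  E i x y = x ≢ y × χ x y ≡ i

  E? : ∀ i x y → Dec (E i x y)
  E? i x y = ¬? (x ≟ y) ×-dec (χ x y ≟ i)

  E-sym : ∀ {i x y} → E i x y → E i y x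
  E-sym {i} {x} {y} (ne , e) = ≢-sym ne , trans (χ-sym y x) e

  Clique : ∀ {p} → Fin k → (Fin p → Fin n) → Set
  Clique i x = ∀ {m m'} → m ≢ m' → E i (x m) (x m')

  HasClique : ℕ → Fin k → Sub n → Set
  HasClique p i S = Σ (Fin p → Fin n) λ x → (∀ m → x m ∈ S) × Clique i x

  Free : ℕ → Fin k → Sub n → Set
  Free p i S = ¬ HasClique p i S

  nbr : Fin k → Fin n → Sub n → Sub n
  nbr i v S = restrict S (E? i v)

  clique-mono : ∀ {p i} (A S : Sub n) → A ⊆ S → HasClique p i A → HasClique p i S
  clique-mono A S A⊆S (x , x∈ , cl) = x , (λ m → A⊆S _ (x∈ m)) , cl

  clique-cons : ∀ {p i v} (S : Sub n) → v ∈ S → ((x , _) : HasClique p i S) → (∀ m → E i v (x m)) → HasClique (suc p) i S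
  clique-cons {p} {i} {v} S v∈ (x , x∈ , cl) adj = v ∷ᶠ x , mem , cl'
    where
    mem : ∀ m → (v ∷ᶠ x) m ∈ S
    mem zero    = v∈
    mem (suc m) = x∈ m
    cl' : Clique i (v ∷ᶠ x)
    cl' {zero}  {zero}   ne = contradiction refl ne
    cl' {zero}  {suc m'} ne = adj m'
    cl' {suc m} {zero}   ne = E-sym (adj m)
    cl' {suc m} {suc m'} ne = cl (ne ∘ cong suc)

  cone-clique : ∀ {p i v} (S T : Sub n) → v ∈ S → T ⊆ S → (∀ {y} → y ∈ T → E i v y) → HasClique p i T → HasClique (suc p) i S
  cone-clique S T v∈ T⊆S adj K@(x , x∈ , cl) = clique-cons S v∈ (clique-mono T S T⊆S K) (λ m → adj (x∈ m))

  edge-clique : ∀ {i x y} (S : Sub n) → x ∈ S → y ∈ S → E i x y → HasClique 2 i S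
  edge-clique S x∈ y∈ e = clique-cons S x∈ (clique-cons S y∈ ((λ ()) , (λ ()) , λ { {()} }) (λ ())) (λ { zero → e ; (suc ()) })

  hasClique? : ∀ p i (S : Sub n) → Dec (HasClique p i S)
  hasClique? zero    i S = yes ((λ ()) , (λ ()) , λ { {()} })
  hasClique? (suc p) i S = map′
    (λ (v , v∈ , K) → cone-clique S (nbr i v S) v∈ (λ _ → proj₁) proj₂ K)
    (λ (x , x∈ , cl) → x zero , x∈ zero , x ∘ suc , (λ m → x∈ (suc m) , cl λ ()) , λ {m} {m'} ne → cl (ne ∘ suc-injective))
    (any? λ v → (v ∈? S) ×-dec hasClique? p i (nbr i v S))

  -- Two-colour Ramsey bounds

  -- `N` plays the role of R(p,q) - 1. The colours are quantified inside, so one bound serves every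
  -- pair, which `ramsey-swap` relies on.
  RamseyBound : ℕ → ℕ → ℕ → Set₁
  RamseyBound p q N = ∀ {a b} (S : Sub n) → (∀ {x y} → x ∈ S → y ∈ S → x ≢ y → E a x y ⊎ E b x y) →
    Free p a S → Free q b S → size S ≤ N

  ramsey-swap : ∀ {p q N} → RamseyBound p q N → RamseyBound q p N
  ramsey-swap bd S two fa fb = bd S (λ x∈ y∈ ne → swap (two x∈ y∈ ne)) fb fa

  ramsey-one : ∀ {q} → RamseyBound 1 q 0
  ramsey-one S two fa fb = ≤-reflexive (size-empty S λ x x∈ → fa (clique-cons S x∈ ((λ ()) , (λ ()) , λ { {()} }) (λ ())))

  nbrs-cover : ∀ {a b v} (S : Sub n) → (∀ {x y} → x ∈ S → y ∈ S → x ≢ y → E a x y ⊎ E b x y) → v ∈ S →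
    size S ≤ suc (size (nbr a v S) + size (nbr b v S))
  nbrs-cover {a} {b} {v} S two v∈ = ≤-trans (size-delete S v) (s≤s (size-cover (S ∖ ｛ v ｝) (nbr a v S) (nbr b v S) split))
    where
    split : ∀ x → x ∈ S ∖ ｛ v ｝ → x ∈ nbr a v S ⊎ x ∈ nbr b v S
    split x (x∈ , x≢v) with two v∈ x∈ (≢-sym x≢v)
    ... | inj₁ e = inj₁ (x∈ , e)
    ... | inj₂ e = inj₂ (x∈ , e)

  nbr-free : ∀ {p i v} (S : Sub n) → v ∈ S → Free (suc p) i S → Free p i (nbr i v S)
  nbr-free {i = i} {v} S v∈ fr K = fr (cone-clique S (nbr i v S) v∈ (λ _ → proj₁) proj₂ K)

  module _ {p q M N} (left : RamseyBound p (suc q) M) (right : RamseyBound (suc p) q N) where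

    nbrs-bounds : ∀ {a b v} (S : Sub n) → (∀ {x y} → x ∈ S → y ∈ S → x ≢ y → E a x y ⊎ E b x y) →
      Free (suc p) a S → Free (suc q) b S → v ∈ S → size (nbr a v S) ≤ M × size (nbr b v S) ≤ N
    nbrs-bounds {a} {b} {v} S two fa fb v∈ =
      left (nbr a v S) (λ (x∈ , _) (y∈ , _) → two x∈ y∈) (nbr-free S v∈ fa) (fb ∘ clique-mono (nbr a v S) S (λ _ → proj₁)) ,
      right (nbr b v S) (λ (x∈ , _) (y∈ , _) → two x∈ y∈) (fa ∘ clique-mono (nbr b v S) S (λ _ → proj₁)) (nbr-free S v∈ fb)

    -- The Erdős-Szekeres recursion R(p+1,q+1) ≤ R(p,q+1) + R(p+1,q), read off at one vertex: its
    -- neighbours in either colour and the vertex itself.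
    ramsey-step : RamseyBound (suc p) (suc q) (suc (M + N))
    ramsey-step S two fa fb with nonempty? S
    ... | no empty = ≤-trans (≤-reflexive (size-empty S λ x x∈ → empty (x , x∈))) z≤n
    ... | yes (v , v∈) with l , r ← nbrs-bounds S two fa fb v∈ =
      ≤-trans (nbrs-cover S two v∈) (s≤s (+-mono-≤ l r))

  ramsey-2-2 : RamseyBound 2 2 1
  ramsey-2-2 = ramsey-step ramsey-one (ramsey-swap ramsey-one)

  ramsey-2-3 : RamseyBound 2 3 2
  ramsey-2-3 = ramsey-step ramsey-one ramsey-2-2

  ramsey-2-4 : RamseyBound 2 4 3
  ramsey-2-4 = ramsey-step ramsey-one ramsey-2-3

  ramsey-3-3 : RamseyBound 3 3 5
  ramsey-3-3 = ramsey-step ramsey-2-3 (ramsey-swap ramsey-2-3)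

  -- On 9 vertices the graph in the first colour would be 3-regular, contradicting the handshake lemma.
  ramsey-3-4 : RamseyBound 3 4 8
  ramsey-3-4 {a} {b} S two fa fb with size S ≤? 8
  ... | yes S≤8 = S≤8
  ... | no  S≰8 = ⊥-elim (odd (proj₁ even) (trans (sym (proj₂ even)) (trans (sum-cong-≗ regular) (trans (sum-scale 3 (λ x → indicator (x ∈? S))) (cong (3 *_) size≡9)))))
    where
    size≡9 : size S ≡ 9
    size≡9 = ≤-antisym (ramsey-step ramsey-2-4 ramsey-3-3 S two fa fb) (≰⇒> S≰8)
    sum-scale : ∀ {n} m (f : Fin n → ℕ) → sum (λ x → m * f x) ≡ m * sum f
    sum-scale {zero}  m f = sym (*-zeroʳ m)
    sum-scale {suc n} m f = trans (cong (m * f zero +_) (sum-scale m (f ∘ suc))) (sym (*-distribˡ-+ m (f zero) _))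
    Adj : ∀ x y → Dec (x ∈ S × y ∈ S × E a x y)
    Adj x y = (x ∈? S) ×-dec (y ∈? S) ×-dec E? a x y
    even = even-sum-sym (λ x y → indicator (Adj x y))
      (λ x → irreflexive x (Adj x x))
      (λ x y → indicator-⇔ (Adj x y) (Adj y x) (λ (p , q , e) → q , p , E-sym e) (λ (p , q , e) → q , p , E-sym e))
      where
      irreflexive : ∀ x (d : Dec (x ∈ S × x ∈ S × E a x x)) → indicator d ≡ 0
      irreflexive x (yes (_ , _ , ne , _)) = contradiction refl ne
      irreflexive x (no _) = refl
    degree : ∀ {x} → x ∈ S → size (nbr a x S) ≡ 3
    degree {x} x∈ with l , r ← nbrs-bounds ramsey-2-4 ramsey-3-3 S two fa fb x∈ =
      ≤-antisym l (+-cancelʳ-≤ 5 3 _ (≤-pred (≤-trans (≤-reflexive (sym size≡9))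
        (≤-trans (nbrs-cover S two x∈) (s≤s (+-monoʳ-≤ (size (nbr a x S)) r))))))
    regular : ∀ x → sum (λ y → indicator (Adj x y)) ≡ 3 * indicator (x ∈? S)
    regular x = at (x ∈? S)
      where
      at : (d : Dec (x ∈ S)) → sum (λ y → indicator (Adj x y)) ≡ 3 * indicator d
      at (yes x∈) = trans (sum-cong-≗ (λ y → indicator-⇔ (Adj x y) (y ∈? nbr a x S) proj₂ (x∈ ,_))) (degree x∈)
      at (no x∉)  = size-empty (record { mem? = Adj x }) (λ _ → x∉ ∘ proj₁)
    odd : ∀ h → h + h ≢ 27
    odd h e with h ≤? 13
    ... | yes h≤ = <⇒≢ (s≤s (+-mono-≤ h≤ h≤)) e
    ... | no  h≰ = <⇒≢ (+-mono-≤ (≰⇒> h≰) (≰⇒> h≰)) (sym e)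

  ramsey-4-4 : RamseyBound 4 4 17
  ramsey-4-4 = ramsey-step ramsey-3-4 (ramsey-swap ramsey-3-4)

  -- What avoiding `H₂` leaves in the neighbourhood of a vertex: a triangle there closes to a K₄
  -- with that vertex, and a further neighbour with an edge into the triangle would complete an H₂.
  IsolatedTriangles : Fin k → Sub n → Set
  IsolatedTriangles i B = ∀ {x : Fin 3 → Fin n} → (∀ m → x m ∈ B) → Clique i x → ∀ {w} → w ∈ B → (∀ m → w ≢ x m) → ∀ m → ¬ E i w (x m)

  -- One vertex is dropped from each triangle.
  thin : ∀ m i (B : Sub n) → size B ≤ m → IsolatedTriangles i B →
    Σ (Sub n) λ B* → B* ⊆ B × Free 3 i B* × 2 * size B ≤ 3 * size B*
  thin m i B B≤ iso with hasClique? 3 i B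
  ... | no free = B , (λ _ → id) , free , *-monoˡ-≤ (size B) {2} {3} (s≤s (s≤s z≤n))
  thin zero i B B≤ iso | yes (x , x∈ , cl) = contradiction (≤-trans (size-pos B (x∈ zero)) B≤) λ ()
  thin (suc m) i B B≤ iso | yes (x , x∈ , cl) = result
    where
    B' = B ∖ ｛ x 0F ｝ ∖ ｛ x 1F ｝ ∖ ｛ x 2F ｝
    avoid : ∀ {y} → y ∈ B' → ∀ m → y ≢ x m
    avoid (((_ , p) , q) , r) 0F = p
    avoid (((_ , p) , q) , r) 1F = q
    avoid (((_ , p) , q) , r) 2F = r
    B'⊆ : B' ⊆ B
    B'⊆ _ (((p , _) , _) , _) = p
    B'≤ : size B' ≤ m
    B'≤ = ≤-pred (≤-trans (size-insert B B' B'⊆ (x∈ 0F) (λ p → avoid p 0F refl)) B≤)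
    B≤B' : size B ≤ 3 + size B'
    B≤B' = ≤-trans (size-delete B (x 0F)) (s≤s (≤-trans (size-delete (B ∖ ｛ x 0F ｝) (x 1F)) (s≤s (size-delete _ (x 2F)))))
    result : Σ (Sub n) λ B* → B* ⊆ B × Free 3 i B* × 2 * size B ≤ 3 * size B*
    result with C , C⊆ , free , large ← thin m i B' B'≤ (λ y∈ cl w∈ → iso (λ m → B'⊆ _ (y∈ m)) cl (B'⊆ _ w∈))
      = B* , B*⊆ , free* , (begin
        2 * size B             ≤⟨ *-monoʳ-≤ 2 B≤B' ⟩
        2 * (3 + size B')      ≡⟨ *-distribˡ-+ 2 3 (size B') ⟩
        6 + 2 * size B'        ≤⟨ +-monoʳ-≤ 6 large ⟩
        6 + 3 * size C         ≡⟨ *-distribˡ-+ 3 2 (size C) ⟨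
        3 * (2 + size C)       ≤⟨ *-monoʳ-≤ 3 B*≥ ⟩
        3 * size B*            ∎)
      where
      open ≤-Reasoning
      -- Two vertices of the triangle return: three removed from `B` against two kept preserves the
      -- ratio of 3 to 2.
      C₁ = C ∪ ｛ x 0F ｝
      B* = C₁ ∪ ｛ x 1F ｝
      B*⊆ : B* ⊆ B
      B*⊆ y (inj₁ (inj₁ p)) = B'⊆ y (C⊆ y p)
      B*⊆ y (inj₁ (inj₂ refl)) = x∈ 0F
      B*⊆ y (inj₂ refl) = x∈ 1F
      B*≥ : 2 + size C ≤ size B*
      B*≥ = ≤-trans (s≤s (size-insert C₁ C (λ _ → inj₁) (inj₂ refl) (λ p → avoid (C⊆ _ p) 0F refl)))
        (size-insert B* C₁ (λ _ → inj₁) (inj₂ refl)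
          [ (λ p → avoid (C⊆ _ p) 1F refl) , (λ e → proj₁ (cl {1F} {0F} λ ()) e) ])
      far : ∀ {y m} → y ∈ C → ¬ E i y (x m)
      far {y} {m} y∈ = iso x∈ cl (B'⊆ y (C⊆ y y∈)) (avoid (C⊆ y y∈)) m
      kind : ∀ {y} → y ∈ B* → y ∈ C ⊎ y ≡ x 0F ⊎ y ≡ x 1F
      kind (inj₁ (inj₁ p)) = inj₁ p
      kind (inj₁ (inj₂ e)) = inj₂ (inj₁ e)
      kind (inj₂ e) = inj₂ (inj₂ e)
      near : ∀ {y z} → y ∈ C → z ∈ B* → E i y z → z ∈ C
      near y∈ z∈ e with kind z∈
      ... | inj₁ p = p
      ... | inj₂ (inj₁ refl) = contradiction e (far {m = 0F} y∈)
      ... | inj₂ (inj₂ refl) = contradiction e (far {m = 1F} y∈)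
      free* : Free 3 i B*
      -- `C` has no edge to the two returned vertices, so a triangle meeting `C` lies inside `C`;
      -- any other would have three vertices among two.
      free* (y , y∈ , cl*) with m , p , q ← pigeonhole₃ {x = y} {x 0F} {x 1F} (λ ne → proj₁ (cl* ne)) = [ p , q ] (old m)
        where
        old : ∀ m → y m ≡ x 0F ⊎ y m ≡ x 1F
        old m with kind (y∈ m)
        ... | inj₂ e = e
        ... | inj₁ p = ⊥-elim (free (y , all-C , cl*))
          where
          all-C : ∀ m' → y m' ∈ C
          all-C m' with m ≟ m'
          ... | yes refl = p
          ... | no  ne   = near p (y∈ m') (cl* ne)

  -- x is a K₄ and w a further vertex adjacent to two of its vertices.
  H₂Free : Fin k → Sub n → Set
  H₂Free i S = ((x , _) : HasClique 4 i S) → ∀ {w} → w ∈ S → (∀ m → w ≢ x m) →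
    ∀ {m m'} → m ≢ m' → E i w (x m) → E i w (x m') → ⊥

  Avoids : Ty → Fin k → Sub n → Set
  Avoids K₂     = Free 2
  Avoids K₃ = Free 3
  Avoids H₂       = H₂Free

  Obeys : (Fin k → Ty) → Sub n → Set
  Obeys t S = ∀ j → Avoids (t j) j S

  avoids-mono : ∀ σ i (A S : Sub n) → A ⊆ S → Avoids σ i S → Avoids σ i A
  avoids-mono K₂     i A S A⊆S av = av ∘ clique-mono A S A⊆S
  avoids-mono K₃ i A S A⊆S av = av ∘ clique-mono A S A⊆S
  avoids-mono H₂       i A S A⊆S av K w∈ = av (clique-mono A S A⊆S K) (A⊆S _ w∈)

  obeys-set : ∀ t i σ S → (∀ j → j ≢ i → Avoids (t j) j S) → Avoids σ i S → Obeys (t [ i ≔ σ ]) S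
  obeys-set t i σ S others this j with j ≟ i
  ... | yes refl = subst (λ τ → Avoids τ j S) (sym (updateAt-updates j t)) this
  ... | no  j≢i  = subst (λ τ → Avoids τ j S) (sym (updateAt-minimal j i t j≢i)) (others j j≢i)

  infix 4 _⊊_
  _⊊_ : Sub n → Sub n → Set
  A ⊊ S = A ⊆ S × ∃ λ v → v ∈ S × ¬ v ∈ A

  ⊊-size : ∀ A S → A ⊊ S → size A < size S
  ⊊-size A S (A⊆S , v , v∈ , v∉) = size-insert S A A⊆S v∈ v∉

  -- Joins of two sets in one colour

  module _ {i} (A B S : Sub n) (A⊆S : A ⊆ S) (B⊆S : B ⊆ S) (joined : ∀ {a b} → a ∈ A → b ∈ B → E i a b) where

    join-edges : HasClique 2 i A → HasClique 2 i B → HasClique 4 i S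
    join-edges (x , x∈ , clx) KB@(y , y∈ , _) =
      clique-cons S (A⊆S _ (x∈ 0F)) (cone-clique S B (A⊆S _ (x∈ 1F)) B⊆S (joined (x∈ 1F)) KB)
        (λ { zero → clx λ () ; (suc m) → joined (x∈ 0F) (y∈ m) })

    -- The two edges span a K₄, and a further vertex of `A` is joined to both of its vertices in
    -- `B`. Hence `A` consists of the ends of its edge.
    join-edges-cover : H₂Free i S → (KA : HasClique 2 i A) → HasClique 2 i B →
      ∀ {a} → a ∈ A → a ≢ proj₁ KA 0F → a ≢ proj₁ KA 1F → ⊥
    join-edges-cover h2 KA KB@(_ , y∈ , _) {a} a∈ p q = h2 (join-edges KA KB) (A⊆S a a∈) distinct {2F} {3F} (λ ()) (joined a∈ (y∈ 0F)) (joined a∈ (y∈ 1F))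
      where
      distinct : ∀ m → a ≢ proj₁ (join-edges KA KB) m
      distinct 0F = p
      distinct 1F = q
      distinct (suc (suc m)) = proj₁ (joined a∈ (y∈ m))

    -- A triangle in `A` spans a K₄ with `b`, and `b'` is joined to all three vertices of the
    -- triangle.
    join-triangle-free : H₂Free i S → ∀ {b b'} → b ∈ B → b' ∈ B → b ≢ b' → Free 3 i A
    join-triangle-free h2 {b} {b'} b∈ b'∈ b≢b' K@(x , x∈ , cl) =
      h2 (clique-cons S (B⊆S b b∈) (clique-mono A S A⊆S K) (λ m → E-sym (joined (x∈ m) b∈)))
        (B⊆S b' b'∈) distinct {1F} {2F} (λ ()) (E-sym (joined (x∈ 0F) b'∈)) (E-sym (joined (x∈ 1F) b'∈))
      where
      distinct : ∀ m → b' ≢ (b ∷ᶠ x) m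
      distinct zero    = ≢-sym b≢b'
      distinct (suc m) = ≢-sym (proj₁ (joined (x∈ m) b'∈))

    join-isolated-triangles : H₂Free i S → ∀ {a} → a ∈ A → IsolatedTriangles i B
    join-isolated-triangles h2 {a} a∈ {x} x∈ cl {w} w∈ w≢x m e =
      h2 (clique-cons S (A⊆S a a∈) (x , (λ m → B⊆S _ (x∈ m)) , cl) (λ m → joined a∈ (x∈ m)))
        (B⊆S w w∈) distinct {0F} {suc m} (λ ()) (E-sym (joined a∈ w∈)) e
      where
      distinct : ∀ m → w ≢ (a ∷ᶠ x) m
      distinct zero    = ≢-sym (proj₁ (joined a∈ w∈))
      distinct (suc m) = w≢x m

  pair-size : ∀ (A : Sub n) u v → (∀ {a} → a ∈ A → a ≢ u → a ≢ v → ⊥) → size A ≤ 2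
  pair-size A u v only = ≤-trans (size-delete A u) (s≤s (size-singleton (A ∖ ｛ u ｝) v
    (λ a (a∈ , a≢u) → decidable-stable (a ≟ v) (only a∈ a≢u))))

  -- Inductive bounds with one or two colours retyped, and the case of a join

  module Step (S : Sub n) (t : Fin k → Ty) (obeys : Obeys t S)
    (IH : ∀ S' t' → size S' < size S → Obeys t' S' → size S' ≤ extremal t') where

    avoids-at : ∀ {i σ} → t i ≡ σ → Avoids σ i S
    avoids-at {i} e = subst (λ τ → Avoids τ i S) e (obeys i)

    -- Colour `i` is first switched off, so that `s` and `r` count the other colours and the
    -- inequalities of `Growth s r` compare the values for the different types of `i`.
    module One (i : Fin k) where
      t₀ = t [ i ≔ K₂ ]
      s = sum (isK₃ ∘ t₀)
      r = sum (isH₂ ∘ t₀)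

      value : Ty → ℕ
      value σ = φ (isK₃ σ + s) * ψ (isH₂ σ + r)

      extremal-value : ∀ σ → extremal (t₀ [ i ≔ σ ]) ≡ value σ
      extremal-value σ = extremal-set t₀ i σ (updateAt-updates i t)

      extremal-self : ∀ {σ} → t i ≡ σ → extremal t ≡ value σ
      extremal-self {σ} e = trans (extremal-cong same) (extremal-value σ)
        where
        same : ∀ j → t j ≡ (t₀ [ i ≔ σ ]) j
        same j with j ≟ i
        ... | yes refl = trans e (sym (updateAt-updates i t₀))
        ... | no  j≢i  = trans (sym (updateAt-minimal j i t j≢i)) (sym (updateAt-minimal j i t₀ j≢i))

      bound : ∀ S' σ → S' ⊊ S → Avoids σ i S' → size S' ≤ value σ
      bound S' σ p@(S'⊆S , _) av = ≤-trans
        (IH S' (t₀ [ i ≔ σ ]) (⊊-size S' S p) (obeys-set t₀ i σ S' others av))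
        (≤-reflexive (extremal-value σ))
        where
        others : ∀ j → j ≢ i → Avoids (t₀ j) j S'
        others j j≢i = subst (λ τ → Avoids τ j S') (sym (updateAt-minimal j i t j≢i)) (avoids-mono (t j) j S' S S'⊆S (obeys j))

    module Two (a b : Fin k) (a≢b : a ≢ b) where
      t₁ = t [ a ≔ K₂ ]
      t₀ = t₁ [ b ≔ K₂ ]
      s = sum (isK₃ ∘ t₀)
      r = sum (isH₂ ∘ t₀)

      value : Ty → Ty → ℕ
      value σ τ = φ (isK₃ τ + (isK₃ σ + s)) * ψ (isH₂ τ + (isH₂ σ + r))

      t₀a : t₀ a ≡ K₂
      t₀a = trans (updateAt-minimal a b t₁ a≢b) (updateAt-updates a t)

      extremal-value : ∀ σ τ → extremal ((t₀ [ a ≔ σ ]) [ b ≔ τ ]) ≡ value σ τ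
      extremal-value σ τ = trans
        (extremal-set (t₀ [ a ≔ σ ]) b τ (trans (updateAt-minimal b a t₀ (≢-sym a≢b)) (updateAt-updates b t₁)))
        (cong₂ (λ m n → φ (isK₃ τ + m) * ψ (isH₂ τ + n))
          (sum-set isK₃ t₀ a σ (cong isK₃ t₀a)) (sum-set isH₂ t₀ a σ (cong isH₂ t₀a)))

      t₀-other : ∀ {j} → j ≢ a → j ≢ b → t₀ j ≡ t j
      t₀-other {j} j≢a j≢b = trans (updateAt-minimal j b t₁ j≢b) (updateAt-minimal j a t j≢a)

      extremal-self : ∀ {σ τ} → t a ≡ σ → t b ≡ τ → extremal t ≡ value σ τ
      extremal-self {σ} {τ} p q = trans (extremal-cong same) (extremal-value σ τ)
        where
        same : ∀ j → t j ≡ ((t₀ [ a ≔ σ ]) [ b ≔ τ ]) j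
        same j with j ≟ b
        ... | yes refl = trans q (sym (updateAt-updates b (t₀ [ a ≔ σ ])))
        ... | no  j≢b with j ≟ a
        ...   | yes refl = trans p (trans (sym (updateAt-updates a t₀)) (sym (updateAt-minimal a b (t₀ [ a ≔ σ ]) j≢b)))
        ...   | no  j≢a  = trans (sym (t₀-other j≢a j≢b)) (trans (sym (updateAt-minimal j a t₀ j≢a)) (sym (updateAt-minimal j b (t₀ [ a ≔ σ ]) j≢b)))

      bound : ∀ S' σ τ → S' ⊊ S → Avoids σ a S' → Avoids τ b S' → size S' ≤ value σ τ
      bound S' σ τ p@(S'⊆S , _) avσ avτ = ≤-trans
        (IH S' _ (⊊-size S' S p) (obeys-set (t₀ [ a ≔ σ ]) b τ S' others avτ))
        (≤-reflexive (extremal-value σ τ))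
        where
        others : ∀ j → j ≢ b → Avoids ((t₀ [ a ≔ σ ]) j) j S'
        others j j≢b with j ≟ a
        ... | yes refl = subst (λ τ → Avoids τ j S') (sym (updateAt-updates a t₀)) avσ
        ... | no  j≢a  = subst (λ τ → Avoids τ j S') (sym (trans (updateAt-minimal j a t₀ j≢a) (t₀-other j≢a j≢b)))
                           (avoids-mono (t j) j S' S S'⊆S (obeys j))

    -- Triangles of colour `i` in `B` are isolated, so `thin` keeps two thirds of `B` free of them,
    -- and to that subset induction applies with type `K₃` at `i`.
    star-bound : ∀ {i a} → t i ≡ H₂ → (B : Sub n) → B ⊆ S → a ∈ S → (∀ {b} → b ∈ B → E i a b) →
      (∀ {x} → x ∈ S → x ≢ a → x ∈ B) → size S ≤ extremal t
    star-bound {i} {a} ti B B⊆S a∈ joined cover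
      with B* , B*⊆ , free , large ← thin (size B) i B ≤-refl
        (join-isolated-triangles ｛ a ｝ B S (λ { _ refl → a∈ }) B⊆S (λ { refl → joined }) (avoids-at ti) refl)
      = begin
        size S                  ≤⟨ size-delete S a ⟩
        suc (size (S ∖ ｛ a ｝))  ≤⟨ s≤s (size-mono (S ∖ ｛ a ｝) B (λ x (x∈ , x≢a) → cover x∈ x≢a)) ⟩
        suc (size B)            ≤⟨ star (≤-trans large (*-monoʳ-≤ 3 (bound B* K₃ ((λ x → B⊆S x ∘ B*⊆ x) , a , a∈ , λ a∈B* → proj₁ (joined (B*⊆ a a∈B*)) refl) free))) ⟩
        value H₂                ≡⟨ extremal-self ti ⟨
        extremal t              ∎
      where
      open One i
      open Growth s r
      open ≤-Reasoning

    module _ {i} (A B : Sub n) (A⊆S : A ⊆ S) (B⊆S : B ⊆ S) (cover : ∀ x → x ∈ S → x ∈ A ⊎ x ∈ B)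
      {a₀ b₀} (a₀∈ : a₀ ∈ A) (b₀∈ : b₀ ∈ B) (joined : ∀ {a b} → a ∈ A → b ∈ B → E i a b) where
      open One i
      open Growth s r
      open ≤-Reasoning

      private
        joined′ : ∀ {b a} → b ∈ B → a ∈ A → E i b a
        joined′ b∈ a∈ = E-sym (joined a∈ b∈)
        A⊊S : A ⊊ S
        A⊊S = A⊆S , b₀ , B⊆S b₀ b₀∈ , λ b₀∈A → proj₁ (joined b₀∈A b₀∈) refl
        B⊊S : B ⊊ S
        B⊊S = B⊆S , a₀ , A⊆S a₀ a₀∈ , λ a₀∈B → proj₁ (joined a₀∈ a₀∈B) refl
        size-sum : size S ≤ size A + size B
        size-sum = size-cover S A B cover

      -- For `K₃` neither side keeps an edge of colour `i`. For `H₂` a one-point side gives a star;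
      -- otherwise both sides are triangle-free in colour `i`, and if both have an edge of it, each
      -- has at most two points.
      join-bound : size S ≤ extremal t
      join-bound with t i in ti
      ... | K₂ = ⊥-elim (avoids-at ti (edge-clique S (A⊆S _ a₀∈) (B⊆S _ b₀∈) (joined a₀∈ b₀∈)))
      ... | K₃ = begin
        size S               ≤⟨ size-sum ⟩
        size A + size B      ≤⟨ +-mono-≤ (bound A K₂ A⊊S (λ K → avoids-at ti (cone-clique S A (B⊆S _ b₀∈) A⊆S (joined′ b₀∈) K)))
                                         (bound B K₂ B⊊S (λ K → avoids-at ti (cone-clique S B (A⊆S _ a₀∈) B⊆S (joined a₀∈) K))) ⟩
        x + x                ≤⟨ K₃-join ⟩
        value K₃       ≡⟨ extremal-self ti ⟨
        extremal t           ∎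
      ... | H₂ with any? (λ a → (a ∈? A) ×-dec ¬? (a ≟ a₀)) | any? (λ b → (b ∈? B) ×-dec ¬? (b ≟ b₀))
      ...   | no ¬a | _ = star-bound ti B B⊆S (A⊆S _ a₀∈) (joined a₀∈) rest
        where
        rest : ∀ {x} → x ∈ S → x ≢ a₀ → x ∈ B
        rest {x} x∈ x≢ with cover x x∈
        ... | inj₁ x∈A = contradiction (x , x∈A , x≢) ¬a
        ... | inj₂ x∈B = x∈B
      ...   | yes _ | no ¬b = star-bound ti A A⊆S (B⊆S _ b₀∈) (joined′ b₀∈) rest
        where
        rest : ∀ {x} → x ∈ S → x ≢ b₀ → x ∈ A
        rest {x} x∈ x≢ with cover x x∈
        ... | inj₁ x∈A = x∈A
        ... | inj₂ x∈B = contradiction (x , x∈B , x≢) ¬b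
      ...   | yes (a₁ , a₁∈ , a₁≢) | yes (b₁ , b₁∈ , b₁≢) = by-edges (hasClique? 2 i A) (hasClique? 2 i B)
        where
        freeA : Free 3 i A
        freeA = join-triangle-free A B S A⊆S B⊆S joined (avoids-at ti) b₁∈ b₀∈ b₁≢
        freeB : Free 3 i B
        freeB = join-triangle-free B A S B⊆S A⊆S joined′ (avoids-at ti) a₁∈ a₀∈ a₁≢
        by-edges : Dec (HasClique 2 i A) → Dec (HasClique 2 i B) → size S ≤ extremal t
        by-edges (no ¬A) _ = begin
          size S               ≤⟨ size-sum ⟩
          size A + size B      ≤⟨ +-mono-≤ (bound A K₂ A⊊S ¬A) (bound B K₃ B⊊S freeB) ⟩
          x + y                ≤⟨ H₂-join ⟩
          value H₂             ≡⟨ extremal-self ti ⟨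
          extremal t           ∎
        by-edges _ (no ¬B) = begin
          size S               ≤⟨ size-sum ⟩
          size A + size B      ≤⟨ +-mono-≤ (bound A K₃ A⊊S freeA) (bound B K₂ B⊊S ¬B) ⟩
          y + x                ≡⟨ +-comm y x ⟩
          x + y                ≤⟨ H₂-join ⟩
          value H₂             ≡⟨ extremal-self ti ⟨
          extremal t           ∎
        by-edges (yes KA) (yes KB) = begin
          size S               ≤⟨ size-sum ⟩
          size A + size B      ≤⟨ +-mono-≤ (pair-size A _ _ (join-edges-cover A B S A⊆S B⊆S joined (avoids-at ti) KA KB))
                                           (pair-size B _ _ (join-edges-cover B A S B⊆S A⊆S joined′ (avoids-at ti) KB KA)) ⟩
          4                    ≤⟨ 4≤4x ⟩
          4 * x                ≤⟨ four-blocks ⟩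
          value H₂             ≡⟨ extremal-self ti ⟨
          extremal t           ∎

  -- Partitions in which every part has neighbours in both colours

  record Partition (S : Sub n) (a b : Fin k) : Set where
    field
      rep   : Fin n → Fin n
      idem  : ∀ x → rep (rep x) ≡ rep x
      rep∈  : ∀ {x} → x ∈ S → rep x ∈ S
      cross : ∀ {x y} → x ∈ S → y ∈ S → rep x ≢ rep y → E a x y ⊎ E b x y
      const : ∀ {w x y} → w ∈ S → rep x ≡ rep y → rep w ≢ rep x → χ w x ≡ χ w y
      a≢b   : a ≢ b
      nbr-a : ∀ {z} → z ∈ S → ∃ λ y → y ∈ S × rep z ≢ rep y × E a z y
      nbr-b : ∀ {z} → z ∈ S → ∃ λ y → y ∈ S × rep z ≢ rep y × E b z y

  flip : ∀ {S a b} → Partition S a b → Partition S b a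
  flip P = record
    { rep = rep ; idem = idem ; rep∈ = rep∈ ; const = const ; nbr-a = nbr-b ; nbr-b = nbr-a
    ; cross = λ x∈ y∈ ne → swap (cross x∈ y∈ ne) ; a≢b = ≢-sym a≢b }
    where open Partition P

  module Parts {S : Sub n} {a b : Fin k} (P : Partition S a b) where
    open Partition P

    part : Fin n → Sub n
    part z = restrict S (λ y → rep z ≟ rep y)

    out : Fin k → Fin n → Sub n
    out i z = restrict S (λ y → ¬? (rep z ≟ rep y) ×-dec E? i z y)

    one-colour : ∀ {x y} → E a x y → E b x y → ⊥
    one-colour (_ , p) (_ , q) = a≢b (trans (sym p) q)

    part⊊S : ∀ {z} → z ∈ S → part z ⊊ S
    part⊊S z∈ with y , y∈ , ne , _ ← nbr-a z∈ = (λ _ → proj₁) , y , y∈ , ne ∘ proj₂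

    out⊊S : ∀ {i z} → z ∈ S → out i z ⊊ S
    out⊊S {z = z} z∈ = (λ _ → proj₁) , z , z∈ , λ (_ , ne , _) → ne refl

    out⊆S : ∀ {i z} → out i z ⊆ S
    out⊆S _ = proj₁

    part⊆S : ∀ {z} → part z ⊆ S
    part⊆S _ = proj₁

    part-out : ∀ {i z x y} → x ∈ part z → y ∈ out i z → E i x y
    part-out {i} {z} {x} {y} (x∈ , zx) (y∈ , ne , _ , e) =
      (λ p → ne (trans zx (cong rep p))) , trans (χ-sym x y) (trans (sym (const y∈ zx (≢-sym ne))) (trans (χ-sym y z) e))

    cover : ∀ {z} → z ∈ S → ∀ y → y ∈ S → y ∈ part z ⊎ y ∈ out a z ⊎ y ∈ out b z
    cover {z} z∈ y y∈ with rep z ≟ rep y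
    ... | yes e = inj₁ (y∈ , e)
    ... | no ne with cross z∈ y∈ ne
    ...   | inj₁ e = inj₂ (inj₁ (y∈ , ne , e))
    ...   | inj₂ e = inj₂ (inj₂ (y∈ , ne , e))

    size-split : ∀ {z} → z ∈ S → size S ≤ size (part z) + (size (out a z) + size (out b z))
    size-split {z} z∈ = ≤-trans (size-cover S (part z) (out a z ∪ out b z) (cover z∈))
      (+-monoʳ-≤ (size (part z)) (size-cover (out a z ∪ out b z) (out a z) (out b z) (λ _ → id)))

    out-free : ∀ {p i z} → z ∈ S → Free (suc p) i S → Free p i (out i z)
    out-free {i = i} {z} z∈ free K = free (cone-clique S (out i z) z∈ out⊆S (λ (_ , _ , e) → e) K)

    -- An outside `a`-neighbour of `z` is joined in colour `a` to the whole part and extends every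
    -- clique in it.
    part-free-a : ∀ {p z} → z ∈ S → Free (suc p) a S → Free p a (part z)
    part-free-a {z = z} z∈ free K with y , y∈ , ne , e ← nbr-a z∈ =
      free (cone-clique S (part z) y∈ part⊆S (λ x∈ → E-sym (part-out x∈ (y∈ , ne , e))) K)

    part-free-b : ∀ {p z} → z ∈ S → Free (suc p) b S → Free p b (part z)
    part-free-b {z = z} z∈ free K with y , y∈ , ne , e ← nbr-b z∈ =
      free (cone-clique S (part z) y∈ part⊆S (λ x∈ → E-sym (part-out x∈ (y∈ , ne , e))) K)

    out-free-of-edge : ∀ {i z} → HasClique 2 i (part z) → Free 4 i S → Free 2 i (out i z)
    out-free-of-edge {i} {z} K free K' = free (join-edges (part z) (out i z) S part⊆S out⊆S part-out K K')

    reps : Sub n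
    reps = restrict S (λ x → rep x ≟ x)

    reps-two-coloured : ∀ {x y} → x ∈ reps → y ∈ reps → x ≢ y → E a x y ⊎ E b x y
    reps-two-coloured (x∈ , rx) (y∈ , ry) x≢y = cross x∈ y∈ (λ e → x≢y (trans (sym rx) (trans e ry)))

    -- One representative per part gives a complete graph coloured with `a` and `b` only, so `N`
    -- bounds the number of parts.
    reps-bound : ∀ {p q N u} → RamseyBound p q N → Free p a S → Free q b S →
      (∀ {z} → z ∈ S → size (part z) ≤ u) → size S ≤ N * u
    reps-bound {N = N} {u} bd fa fb part≤ = size-fibres N S reps rep u
      (bd reps reps-two-coloured (fa ∘ clique-mono reps S (λ _ → proj₁)) (fb ∘ clique-mono reps S (λ _ → proj₁)))
      (λ x x∈ → rep∈ x∈ , idem x) fibre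
      where
      fibre : ∀ z → size (restrict S (λ x → rep x ≟ z)) ≤ u
      fibre z with nonempty? (restrict S (λ x → rep x ≟ z))
      ... | no empty = ≤-trans (≤-reflexive (size-empty (restrict S (λ x → rep x ≟ z)) λ x x∈ → empty (x , x∈))) z≤n
      ... | yes (y , y∈ , e) = ≤-trans (size-mono (restrict S (λ x → rep x ≟ z)) (part y) (λ x (x∈ , e') → x∈ , trans e (sym e'))) (part≤ y∈)

  -- Bounds for partitions, by the types of the two crossing colours

  module NonJoin (S : Sub n) (t : Fin k → Ty) (obeys : Obeys t S)
    (IH : ∀ S' t' → size S' < size S → Obeys t' S' → size S' ≤ extremal t') where
    open Step S t obeys IH

    module _ {a b} (P : Partition S a b) where
      open Partition P
      open Parts P
      open Two a b a≢b
      open Growth s r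
      open ≤-Reasoning

      -- If a part contains a triangle in an H₂-colour b, then it has a single b-neighbour b₀. Adding b₀ to
      -- the part creates no edge of colour a, so the part together with b₀ can be bounded by induction.
      part-triangle-bound : t b ≡ H₂ → ∀ {z} → z ∈ S → HasClique 3 b (part z) → size S ≤ extremal t
      part-triangle-bound tb {z} z∈ K@(x , x∈ , clx)
        with b₀ , b₀∈S , zb₀ , eb₀ ← nbr-b z∈ | c₀ , c₀∈S , zc₀ , ec₀ ← nbr-a z∈ = by-type
        where
        A = part z
        A⁺ = A ∪ ｛ b₀ ｝
        C = out a z
        b₀∈ : b₀ ∈ out b z
        b₀∈ = b₀∈S , zb₀ , eb₀
        c₀∈ : c₀ ∈ C
        c₀∈ = c₀∈S , zc₀ , ec₀
        b₀-only : ∀ {y} → y ∈ out b z → y ≡ b₀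
        b₀-only {y} y∈ = decidable-stable (y ≟ b₀) λ y≢b₀ →
          join-triangle-free A (out b z) S part⊆S out⊆S part-out (avoids-at tb) y∈ b₀∈ y≢b₀ K
        A⁺-b₀ : ∀ {y} → y ∈ A → E b y b₀
        A⁺-b₀ y∈ = part-out y∈ b₀∈
        split : ∀ y → y ∈ S → y ∈ A⁺ ⊎ y ∈ C
        split y y∈ with cover z∈ y y∈
        ... | inj₁ p = inj₁ (inj₁ p)
        ... | inj₂ (inj₁ p) = inj₂ p
        ... | inj₂ (inj₂ p) = inj₁ (inj₂ (b₀-only p))
        size-sum : size S ≤ size A⁺ + size C
        size-sum = size-cover S A⁺ C split
        A⁺⊆S : A⁺ ⊆ S
        A⁺⊆S _ (inj₁ p) = proj₁ p
        A⁺⊆S _ (inj₂ refl) = b₀∈S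
        A⁺⊊S : A⁺ ⊊ S
        A⁺⊊S = A⁺⊆S , c₀ , c₀∈S , [ zc₀ ∘ proj₂ , (λ { refl → one-colour ec₀ eb₀ }) ]
        A⁺-free : ∀ {p} → Free (2 + p) a A → Free (2 + p) a A⁺
        A⁺-free {p} free (y , y∈ , cly) = free (y , inside , λ {m} {m'} → cly {m} {m'})
          where
          partner : ∀ (m : Fin (2 + p)) → ∃ λ m' → m ≢ m'
          partner zero = 1F , λ ()
          partner (suc m) = 0F , λ ()
          inside : ∀ m → y m ∈ A
          inside m with y∈ m | partner m
          ... | inj₁ q | _ = q
          ... | inj₂ q | m' , ne with y∈ m'
          ...   | inj₁ q' = ⊥-elim (one-colour (cly (≢-sym ne)) (subst (E b (y m')) (sym q) (A⁺-b₀ q')))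
          ...   | inj₂ q' = contradiction (trans q (sym q')) (proj₁ (cly ne))
        A⁺-H₂ : H₂Free b A⁺
        A⁺-H₂ = avoids-mono H₂ b A⁺ S A⁺⊆S (avoids-at tb)
        C-H₂ : H₂Free b C
        C-H₂ = avoids-mono H₂ b C S out⊆S (avoids-at tb)
        -- An `a`-neighbour of `b₀` outside its part must lie in `C`, and so must a `b`-neighbour of
        -- that vertex; these two points let `join-triangle-free` act on `A`.
        C-pair : ∃ λ c₁ → ∃ λ c₂ → c₁ ∈ C × c₂ ∈ C × c₁ ≢ c₂
        C-pair with c₁ , c₁∈S , _ , e₁ ← nbr-a b₀∈S with split c₁ c₁∈S
        ... | inj₁ (inj₁ p) = ⊥-elim (one-colour (E-sym e₁) (A⁺-b₀ p))
        ... | inj₁ (inj₂ p) = contradiction (sym p) (proj₁ e₁)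
        ... | inj₂ c₁∈ with c₂ , c₂∈S , _ , e₂ ← nbr-b c₁∈S with split c₂ c₂∈S
        ...   | inj₁ (inj₁ p) = ⊥-elim (one-colour (part-out p c₁∈) (E-sym e₂))
        ...   | inj₁ (inj₂ refl) = ⊥-elim (one-colour e₁ (E-sym e₂))
        ...   | inj₂ c₂∈ = c₁ , c₂ , c₁∈ , c₂∈ , proj₁ e₂
        by-type : size S ≤ extremal t
        by-type with t a in ta
        ... | K₂ = ⊥-elim (avoids-at ta (edge-clique S z∈ c₀∈S ec₀))
        ... | K₃ = begin
          size S                ≤⟨ size-sum ⟩
          size A⁺ + size C      ≤⟨ +-mono-≤ (bound A⁺ K₂ H₂ A⁺⊊S (A⁺-free (part-free-a z∈ (avoids-at ta))) A⁺-H₂)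
                                            (bound C K₂ H₂ (out⊊S z∈) (out-free z∈ (avoids-at ta)) C-H₂) ⟩
          Growth.z s r + Growth.z s r  ≤⟨ K₃H₂-triangle ⟩
          value K₃ H₂     ≡⟨ extremal-self ta tb ⟨
          extremal t            ∎
        ... | H₂ with c₁ , c₂ , c₁∈ , c₂∈ , c₁≢c₂ ← C-pair with hasClique? 2 a A
        ...   | no ¬KA = begin
          size S                ≤⟨ size-sum ⟩
          size A⁺ + size C      ≤⟨ +-mono-≤ (bound A⁺ K₂ H₂ A⁺⊊S (A⁺-free ¬KA) A⁺-H₂) (bound C K₃ H₂ (out⊊S z∈) C-free C-H₂) ⟩
          Growth.z s r + w      ≤⟨ H₂H₂-triangle ⟩
          value H₂ H₂           ≡⟨ extremal-self ta tb ⟨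
          extremal t            ∎
          where
          C-free : Free 3 a C
          C-free = join-triangle-free C A S out⊆S part⊆S (λ p q → E-sym (part-out q p)) (avoids-at ta) (x∈ 0F) (x∈ 1F) (proj₁ (clx λ ()))
        ...   | yes KA = begin
          size S                ≤⟨ size-sum ⟩
          size A⁺ + size C      ≤⟨ +-mono-≤ (bound A⁺ K₃ H₂ A⁺⊊S (A⁺-free A-free) A⁺-H₂) (bound C K₂ H₂ (out⊊S z∈) C-free C-H₂) ⟩
          w + Growth.z s r      ≡⟨ +-comm w (Growth.z s r) ⟩
          Growth.z s r + w      ≤⟨ H₂H₂-triangle ⟩
          value H₂ H₂           ≡⟨ extremal-self ta tb ⟨
          extremal t            ∎
          where
          A-free : Free 3 a A
          A-free = join-triangle-free A C S part⊆S out⊆S part-out (avoids-at ta) c₁∈ c₂∈ c₁≢c₂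
          C-free : Free 2 a C
          -- With an `a`-edge on both sides, `A` would consist of two points, but it contains a
          -- triangle of colour `b`.
          C-free KC with m , p , q ← pigeonhole₃ {x = x} {proj₁ KA 0F} {proj₁ KA 1F} (λ ne → proj₁ (clx ne)) =
            join-edges-cover A C S part⊆S out⊆S part-out (avoids-at ta) KA KC (x∈ m) p q

      module _ (tb : t b ≡ H₂) (part-free : ∀ {z} → z ∈ S → Free 3 b (part z)) (K : HasClique 4 b S) where
        private
          x₄ = proj₁ K
          x₄∈ = proj₁ (proj₂ K)
          clx : Clique b x₄
          clx = proj₂ (proj₂ K)
          W = S ∖ ｛ x₄ 0F ｝ ∖ ｛ x₄ 1F ｝ ∖ ｛ x₄ 2F ｝ ∖ ｛ x₄ 3F ｝
          W⊆S : W ⊆ S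
          W⊆S _ ((((p , _) , _) , _) , _) = p
          avoid : ∀ {w} → w ∈ W → ∀ m → w ≢ x₄ m
          avoid ((((_ , p) , _) , _) , _) 0F = p
          avoid ((((_ , _) , p) , _) , _) 1F = p
          avoid ((((_ , _) , _) , p) , _) 2F = p
          avoid ((((_ , _) , _) , _) , p) 3F = p
          W⊊S : W ⊊ S
          W⊊S = W⊆S , x₄ 0F , x₄∈ 0F , λ p → avoid p 0F refl
          size-W : size S ≤ 4 + size W
          size-W = ≤-trans (size-delete S (x₄ 0F)) (s≤s (≤-trans (size-delete (S ∖ ｛ x₄ 0F ｝) (x₄ 1F))
            (s≤s (≤-trans (size-delete (S ∖ ｛ x₄ 0F ｝ ∖ ｛ x₄ 1F ｝) (x₄ 2F)) (s≤s (size-delete _ (x₄ 3F)))))))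

          at-most-one : ∀ {w m m'} → w ∈ W → m ≢ m' → E b w (x₄ m) → E b w (x₄ m') → ⊥
          at-most-one {w} w∈ = avoids-at tb K (W⊆S w w∈) (avoid w∈)

          -- Suppose that `w` shares a part with a vertex of the K₄. Every vertex of the K₄ outside
          -- that part then sees `w` in colour `b`, so by `at-most-one` there is at most one, and
          -- the others contain a `b`-triangle inside the part.
          outside : ∀ {w} → w ∈ W → ∀ m → rep w ≢ rep (x₄ m)
          outside {w} w∈ m e with any? (λ m' → ¬? (rep w ≟ rep (x₄ m')))
          ... | no all-in = part-free (W⊆S w w∈)
            (x₄ ∘ suc , (λ q → x₄∈ (suc q) , decidable-stable (rep w ≟ rep (x₄ (suc q))) (λ ne → all-in (_ , ne))) ,
             λ ne → clx (ne ∘ suc-injective))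
          ... | yes (m' , ne') = part-free (W⊆S w w∈)
            (x₄ ∘ punchIn m' , (λ q → x₄∈ (punchIn m' q) , decidable-stable (rep w ≟ rep (x₄ (punchIn m' q)))
               (λ ne → at-most-one w∈ (punchInᵢ≢i m' q) (seen _ ne) (seen m' ne'))) ,
             λ ne → clx (ne ∘ punchIn-injective m' _ _))
            where
            seen : ∀ m'' → rep w ≢ rep (x₄ m'') → E b w (x₄ m'')
            seen m'' ne = part-out {z = x₄ m} (W⊆S w w∈ , sym e)
              (x₄∈ m'' , (λ q → ne (trans e q)) , clx (λ q → ne (trans e (cong (rep ∘ x₄) q))))

          exception : ∀ {w} → w ∈ W → ∃ λ e → ∀ m → m ≢ e → E a w (x₄ m)
          exception {w} w∈ with any? (λ m → E? b w (x₄ m))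
          -- No edge of colour `b` goes from `w` to the K₄, so any index can serve as the exception.
          ... | no none = 0F , λ m _ → [ id , (λ p → contradiction (m , p) none) ] (cross (W⊆S w w∈) (x₄∈ m) (outside w∈ m))
          ... | yes (e , p) = e , λ m m≢e → [ id , (λ q → ⊥-elim (at-most-one w∈ m≢e q p)) ] (cross (W⊆S w w∈) (x₄∈ m) (outside w∈ m))

          W-H₂ : H₂Free b W
          W-H₂ = avoids-mono H₂ b W S W⊆S (avoids-at tb)

        -- Every vertex outside the K₄ sends at least three edges of colour a to it, so common a-neighbours abound.
        clique-bound : size S ≤ extremal t
        clique-bound with t a in ta
        ... | K₂ with y , y∈ , _ , e ← nbr-a (x₄∈ 0F) = ⊥-elim (avoids-at ta (edge-clique S (x₄∈ 0F) y∈ e))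
        clique-bound | K₃ = begin
          size S                 ≤⟨ size-W ⟩
          4 + size W             ≤⟨ +-mono-≤ 4≤4x (bound W K₂ H₂ W⊊S W-free W-H₂) ⟩
          4 * x + z              ≤⟨ K₃H₂-clique ⟩
          value K₃ H₂      ≡⟨ extremal-self ta tb ⟨
          extremal t             ∎
          where
          W-free : Free 2 a W
          W-free KW@(y , y∈ , cly) with e₀ , f₀ ← exception (y∈ 0F) | e₁ , f₁ ← exception (y∈ 1F)
            with m , p , q , _ ← fresh e₀ e₁ e₁ = avoids-at ta (clique-cons S (x₄∈ m) (clique-mono W S W⊆S KW)
              (λ { 0F → E-sym (f₀ m p) ; 1F → E-sym (f₁ m q) }))
        clique-bound | H₂ = begin
          size S                 ≤⟨ size-W ⟩
          4 + size W             ≤⟨ +-mono-≤ 4≤4x (bound W K₃ H₂ W⊊S W-free W-H₂) ⟩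
          4 * x + w              ≤⟨ H₂H₂-clique ⟩
          value H₂ H₂            ≡⟨ extremal-self ta tb ⟨
          extremal t             ∎
          where
          W-free : Free 3 a W
          W-free KW@(y , y∈ , cly)
            with e₀ , f₀ ← exception (y∈ 0F) | e₁ , f₁ ← exception (y∈ 1F) | e₂ , f₂ ← exception (y∈ 2F)
            with m , p₀ , p₁ , p₂ ← fresh e₀ e₁ e₂
            -- `x₄ m` completes the triangle to a K₄. The fifth vertex `x₄ m'` must see only two of
            -- its vertices, so besides `m` it has two exceptions to avoid, and four indices
            -- suffice.
            with m' , q , q₀ , q₁ ← fresh m e₀ e₁ =
            avoids-at ta (clique-cons S (x₄∈ m) (clique-mono W S W⊆S KW)
                (λ { 0F → E-sym (f₀ m p₀) ; 1F → E-sym (f₁ m p₁) ; 2F → E-sym (f₂ m p₂) }))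
              (x₄∈ m') distinct {1F} {2F} (λ ()) (E-sym (f₀ m' q₀)) (E-sym (f₁ m' q₁))
            where
            distinct : ∀ q' → x₄ m' ≢ (x₄ m ∷ᶠ y) q'
            distinct zero    = proj₁ (clx q)
            distinct (suc q') = ≢-sym (avoid (y∈ q') m')

      K₃K₃-bound : t a ≡ K₃ → t b ≡ K₃ → size S ≤ extremal t
      K₃K₃-bound ta tb = begin
        size S                    ≤⟨ reps-bound ramsey-3-3 (avoids-at ta) (avoids-at tb) (λ {z} z∈ →
                                       bound (part z) K₂ K₂ (part⊊S z∈) (part-free-a z∈ (avoids-at ta)) (part-free-b z∈ (avoids-at tb))) ⟩
        5 * x                     ≡⟨ *-assoc 5 (φ s) (ψ r) ⟨
        value K₃ K₃   ≡⟨ extremal-self ta tb ⟨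
        extremal t                ∎

      edge-in-part? : ∀ i → Dec (∃ λ z → z ∈ S × HasClique 2 i (part z))
      edge-in-part? i = any? λ z → (z ∈? S) ×-dec hasClique? 2 i (part z)

      -- A `b`-edge in a part and one in its `b`-neighbourhood would form a K₄, so that
      -- neighbourhood loses colour `b` altogether; the part and its `a`-neighbourhood lose colour
      -- `a`.
      K₃H₂-bound : t a ≡ K₃ → t b ≡ H₂ → (∀ {z} → z ∈ S → Free 3 b (part z)) → Free 4 b S → size S ≤ extremal t
      K₃H₂-bound ta tb part-free free with edge-in-part? b
      ... | yes (z₀ , z₀∈ , K) = begin
        size S                    ≤⟨ size-split z₀∈ ⟩
        _                         ≤⟨ +-mono-≤ (bound (part z₀) K₂ K₃ (part⊊S z₀∈) (part-free-a z₀∈ (avoids-at ta)) (part-free z₀∈))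
                                       (+-mono-≤ (bound (out a z₀) K₂ H₂ (out⊊S z₀∈) (out-free z₀∈ (avoids-at ta)) (avoids-mono H₂ b (out a z₀) S out⊆S (avoids-at tb)))
                                                 (bound (out b z₀) K₃ K₂ (out⊊S z₀∈) (avoids-mono K₃ a (out b z₀) S out⊆S (avoids-at ta)) (out-free-of-edge K free))) ⟩
        y + (z + y)               ≤⟨ K₃H₂-edge ⟩
        value K₃ H₂         ≡⟨ extremal-self ta tb ⟨
        extremal t                ∎
      ... | no none = begin
        size S                    ≤⟨ reps-bound ramsey-3-4 (avoids-at ta) free (λ {z} z∈ →
                                       bound (part z) K₂ K₂ (part⊊S z∈) (part-free-a z∈ (avoids-at ta)) (λ K → none (z , z∈ , K))) ⟩
        8 * x                     ≤⟨ K₃H₂-ramsey ⟩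
        value K₃ H₂         ≡⟨ extremal-self ta tb ⟨
        extremal t                ∎

      module _ (ta : t a ≡ H₂) (tb : t b ≡ H₂) (part-free₁ : ∀ {z} → z ∈ S → Free 3 a (part z))
        (part-free₂ : ∀ {z} → z ∈ S → Free 3 b (part z)) (free₁ : Free 4 a S) (free₂ : Free 4 b S) where

        part-edge-bound : ∀ {z} → z ∈ S → HasClique 2 a (part z) → size S ≤ extremal t
        part-edge-bound {z₀} z₀∈ K with hasClique? 2 b (part z₀)
        ... | yes K' = begin
          size S                    ≤⟨ size-split z₀∈ ⟩
          _                         ≤⟨ +-mono-≤ (bound (part z₀) K₃ K₃ (part⊊S z₀∈) (part-free₁ z₀∈) (part-free₂ z₀∈))
                                         (+-mono-≤ (bound (out a z₀) K₂ H₂ (out⊊S z₀∈) (out-free-of-edge K free₁) (avoids-mono H₂ b (out a z₀) S out⊆S (avoids-at tb)))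
                                                   (bound (out b z₀) H₂ K₂ (out⊊S z₀∈) (avoids-mono H₂ a (out b z₀) S out⊆S (avoids-at ta)) (out-free-of-edge K' free₂))) ⟩
          _                         ≤⟨ H₂H₂-two-edges ⟩
          value H₂ H₂               ≡⟨ extremal-self ta tb ⟨
          extremal t                ∎
        -- Bounding the `a`-neighbourhood by `z` is too weak: for s = r = 1 this gives 20 + 34 + 85
        -- = 139, above the target 136. The sharper bound `x + y` is 28 there instead of 34.
        ... | no ¬K' = begin
          size S                    ≤⟨ size-split z₀∈ ⟩
          _                         ≤⟨ +-mono-≤ (bound (part z₀) K₃ K₂ (part⊊S z₀∈) (part-free₁ z₀∈) ¬K')
                                         (+-mono-≤ out-a≤ (bound (out b z₀) H₂ K₃ (out⊊S z₀∈) (avoids-mono H₂ a (out b z₀) S out⊆S (avoids-at ta)) (out-free z₀∈ free₂))) ⟩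
          y + ((x + y) + w)         ≤⟨ H₂H₂-edge ⟩
          value H₂ H₂               ≡⟨ extremal-self ta tb ⟨
          extremal t                ∎
          where
          N = out a z₀
          N-free : Free 2 a N
          N-free = out-free-of-edge K free₁
          -- N has no edge of colour a, so a part A inside N is joined to the rest of N in colour b.
          out-a≤ : size N ≤ x + y
          out-a≤ with v , v∈S , ne , e ← nbr-a z₀∈ = ≤-trans (size-cover N A B splitN) (by-edge (hasClique? 2 b A))
            where
            v∈ : v ∈ N
            v∈ = v∈S , ne , e
            A = restrict N (λ y → rep v ≟ rep y)
            B = restrict N (λ y → ¬? (rep v ≟ rep y))
            A⊆S : A ⊆ S
            A⊆S _ ((p , _) , _) = p
            B⊆S : B ⊆ S
            B⊆S _ ((p , _) , _) = p
            A⊊S : A ⊊ S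
            A⊊S = A⊆S , z₀ , z₀∈ , λ ((_ , p , _) , _) → p refl
            B⊊S : B ⊊ S
            B⊊S = B⊆S , z₀ , z₀∈ , λ ((_ , p , _) , _) → p refl
            splitN : ∀ y → y ∈ N → y ∈ A ⊎ y ∈ B
            splitN y y∈ with rep v ≟ rep y
            ... | yes p = inj₁ (y∈ , p)
            ... | no  p = inj₂ (y∈ , p)
            joined : ∀ {p q} → p ∈ A → q ∈ B → E b p q
            joined {p} {q} (p∈ , vp) (q∈ , vq) with cross (proj₁ p∈) (proj₁ q∈) (λ e → vq (trans vp e))
            ... | inj₁ e = ⊥-elim (N-free (edge-clique N p∈ q∈ e))
            ... | inj₂ e = e
            A-none : Free 2 a A
            A-none = N-free ∘ clique-mono A N (λ _ → proj₁)
            B-none : Free 2 a B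
            B-none = N-free ∘ clique-mono B N (λ _ → proj₁)
            A-free : Free 3 b A
            A-free = part-free₂ v∈S ∘ clique-mono A (part v) (λ _ ((p , _) , q) → p , q)
            B-free : Free 3 b B
            B-free KB = free₂ (cone-clique S B v∈S B⊆S (joined (v∈ , refl)) KB)
            by-edge : Dec (HasClique 2 b A) → size A + size B ≤ x + y
            by-edge (no ¬KA) = +-mono-≤ (bound A K₂ K₂ A⊊S A-none ¬KA) (bound B K₂ K₃ B⊊S B-none B-free)
            by-edge (yes KA) = ≤-trans
              (+-mono-≤ (bound A K₂ K₃ A⊊S A-none A-free)
                (bound B K₂ K₂ B⊊S B-none (λ KB → free₂ (join-edges A B S A⊆S B⊆S joined KA KB))))
              (≤-reflexive (+-comm y x))

        no-part-edge-bound : (∀ {z} → z ∈ S → Free 2 a (part z)) → (∀ {z} → z ∈ S → Free 2 b (part z)) → size S ≤ extremal t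
        no-part-edge-bound fa fb = begin
          size S                    ≤⟨ reps-bound ramsey-4-4 free₁ free₂ (λ {z} z∈ → bound (part z) K₂ K₂ (part⊊S z∈) (fa z∈) (fb z∈)) ⟩
          17 * x                    ≡⟨ commute (φ s) (ψ r) ⟩
          value H₂ H₂               ≡⟨ extremal-self ta tb ⟨
          extremal t                ∎
          where
          commute : ∀ p q → 17 * (p * q) ≡ p * (17 * q)
          commute = solve-∀

    module _ {a b} (P : Partition S a b) where
      open Partition P
      open Parts P

      private
        part-triangle? : Dec (∃ λ z → z ∈ S × HasClique 3 b (part z))
        part-triangle? = any? λ z → (z ∈? S) ×-dec hasClique? 3 b (part z)

      -- In continuation form, so that for two `H₂`-colours it can be nested, once directly and once
      -- through `flip`.
      unless-K₄ : t b ≡ H₂ → ((∀ {z} → z ∈ S → Free 3 b (part z)) → Free 4 b S → size S ≤ extremal t) → size S ≤ extremal t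
      unless-K₄ tb rest with part-triangle?
      ... | yes (z , z∈ , K) = part-triangle-bound P tb z∈ K
      ... | no none with hasClique? 4 b S
      ...   | yes K = clique-bound P tb (λ {z} z∈ K → none (z , z∈ , K)) K
      ...   | no free = rest (λ {z} z∈ K → none (z , z∈ , K)) free

    partition-bound : ∀ {a b} → Partition S a b → ∀ {v} → v ∈ S → size S ≤ extremal t
    partition-bound {a} {b} P {v} v∈ with t a in ta | t b in tb
    ... | K₂ | _ with y , y∈ , _ , e ← Partition.nbr-a P v∈ = ⊥-elim (avoids-at ta (edge-clique S v∈ y∈ e))
    partition-bound {a} {b} P {v} v∈ | _ | K₂ with y , y∈ , _ , e ← Partition.nbr-b P v∈ = ⊥-elim (avoids-at tb (edge-clique S v∈ y∈ e))
    partition-bound {a} {b} P {v} v∈ | K₃ | K₃ = K₃K₃-bound P ta tb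
    partition-bound {a} {b} P {v} v∈ | K₃ | H₂ = unless-K₄ P tb (K₃H₂-bound P ta tb)
    partition-bound {a} {b} P {v} v∈ | H₂ | K₃ = unless-K₄ (flip P) ta (K₃H₂-bound (flip P) tb ta)
    partition-bound {a} {b} P {v} v∈ | H₂ | H₂ =
      unless-K₄ (flip P) ta λ pf₁ f₁ → unless-K₄ P tb λ pf₂ f₂ →
        by-edge pf₁ f₁ pf₂ f₂ (edge-in-part? P a) (edge-in-part? P b)
      where
      open Parts P
      by-edge : (∀ {z} → z ∈ S → Free 3 a (part z)) → Free 4 a S → (∀ {z} → z ∈ S → Free 3 b (part z)) → Free 4 b S →
        Dec (∃ λ z → z ∈ S × HasClique 2 a (part z)) → Dec (∃ λ z → z ∈ S × HasClique 2 b (part z)) → size S ≤ extremal t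
      by-edge pf₁ f₁ pf₂ f₂ (yes (z , z∈ , K)) _ = part-edge-bound P ta tb pf₁ pf₂ f₁ f₂ z∈ K
      by-edge pf₁ f₁ pf₂ f₂ _ (yes (z , z∈ , K)) = part-edge-bound (flip P) tb ta pf₂ pf₁ f₂ f₁ z∈ K
      by-edge pf₁ f₁ pf₂ f₂ (no p) (no q) = no-part-edge-bound P ta tb pf₁ pf₂ f₁ f₂ (λ z∈ K → p (_ , z∈ , K)) (λ z∈ K → q (_ , z∈ , K))

  -- The upper bound

  extremal-pos : ∀ (t : Fin k → Ty) → 1 ≤ extremal t
  extremal-pos t = Growth.x-pos (sum (isK₃ ∘ t)) (sum (isH₂ ∘ t))

  -- `m` is fuel, which makes the strong induction on `size S` structural.
  upper-bound : ∀ m (S : Sub n) t → size S < m → Obeys t S → size S ≤ extremal t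
  upper-bound (suc m) S t S<m obeys with nonempty? S
  ... | no empty = ≤-trans (≤-reflexive (size-empty S λ x x∈ → empty (x , x∈))) z≤n
  ... | yes (v , v∈) with any? (λ y → (y ∈? S) ×-dec ¬? (v ≟ y))
  ...   | no only = ≤-trans (size-singleton S v (λ x x∈ → decidable-stable (x ≟ v) (λ ne → only (x , x∈ , ≢-sym ne)))) (extremal-pos t)
  ...   | yes (y , y∈ , v≢y) with a , b , Q , x₁ , y₁ , x₁∈ , y₁∈ , x₁≢y₁ ← gallai-partition S v∈ y∈ v≢y = by-neighbours
    where
    open Quotient Q
    IH : ∀ S' t' → size S' < size S → Obeys t' S' → size S' ≤ extremal t'
    IH S' t' lt = upper-bound m S' t' (≤-trans lt (≤-pred S<m))
    open Step S t obeys IH using (join-bound)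
    cross-edge : ∀ {x y} → x ∈ S → y ∈ S → rep x ≢ rep y → E a x y ⊎ E b x y
    cross-edge {x} {y} x∈ y∈ ne with cross x∈ y∈ ne
    ... | here e = inj₁ (ne ∘ cong rep , e)
    ... | there (here e) = inj₂ (ne ∘ cong rep , e)
    has-nbr? : ∀ i z → Dec (∃ λ y → y ∈ S × rep z ≢ rep y × E i z y)
    has-nbr? i z = any? λ y → (y ∈? S) ×-dec ¬? (rep z ≟ rep y) ×-dec E? i z y
    lacks-nbr? : ∀ i → Dec (∃ λ z → z ∈ S × ¬ ∃ λ y → y ∈ S × rep z ≢ rep y × E i z y)
    lacks-nbr? i = any? λ z → (z ∈? S) ×-dec ¬? (has-nbr? i z)
    join-at : ∀ {z i} → z ∈ S → (∀ {y} → y ∈ S → rep z ≢ rep y → E i z y) → size S ≤ extremal t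
    join-at {z} {i} z∈ edge = join-bound A B (λ _ → proj₁) (λ _ → proj₁) split (z∈ , refl) (proj₂ other) joined
      where
      A = restrict S (λ y → rep z ≟ rep y)
      B = restrict S (λ y → ¬? (rep z ≟ rep y))
      split : ∀ x → x ∈ S → x ∈ A ⊎ x ∈ B
      split x x∈ with rep z ≟ rep x
      ... | yes p = inj₁ (x∈ , p)
      ... | no  p = inj₂ (x∈ , p)
      other : ∃ λ y → y ∈ B
      other with rep z ≟ rep x₁
      ... | yes p = y₁ , y₁∈ , λ q → x₁≢y₁ (trans (sym p) q)
      ... | no  p = x₁ , x₁∈ , p
      joined : ∀ {p q} → p ∈ A → q ∈ B → E i p q
      joined {p} {q} (p∈ , zp) (q∈ , zq) = (λ e → zq (trans zp (cong rep e))) ,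
        trans (χ-sym p q) (trans (sym (const q∈ zp (≢-sym zq))) (trans (χ-sym q z) (proj₂ (edge q∈ zq))))
    by-neighbours : size S ≤ extremal t
    by-neighbours with a ≟ b | lacks-nbr? a | lacks-nbr? b
    ... | yes refl | _ | _ = join-at x₁∈ (λ y∈ ne → [ id , id ] (cross-edge x₁∈ y∈ ne))
    ... | no _ | yes (z , z∈ , lacks) | _ = join-at z∈ (λ y∈ ne → [ (λ e → contradiction (_ , y∈ , ne , e) lacks) , id ] (cross-edge z∈ y∈ ne))
    ... | no _ | no _ | yes (z , z∈ , lacks) = join-at z∈ (λ y∈ ne → [ id , (λ e → contradiction (_ , y∈ , ne , e) lacks) ] (cross-edge z∈ y∈ ne))
    ... | no a≢b | no ¬a | no ¬b = NonJoin.partition-bound S t obeys IH (record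
      { rep = rep ; idem = idem ; rep∈ = rep∈ ; cross = cross-edge ; const = const ; a≢b = a≢b
      ; nbr-a = λ {z} z∈ → decidable-stable (has-nbr? a z) (λ none → ¬a (z , z∈ , none))
      ; nbr-b = λ {z} z∈ → decidable-stable (has-nbr? b z) (λ none → ¬b (z , z∈ , none)) }) v∈

-- The lower bound

-- Colours are natural numbers here, so that factors can be nested without renaming; they become
-- elements of `Fin` only at the end.
Copy : ∀ {N m} → (Fin N → Fin N → ℕ) → Graph m → ℕ → Set
Copy {N} {m} κ F i = Σ (Fin m → Fin N) λ f → (∀ {a b} → f a ≡ f b → a ≡ b) × (∀ a b → F a b ≡ true → κ (f a) (f b) ≡ i)

-- Homomorphisms are enough: the outer colouring of a product must not even contain the image of a
-- forbidden graph under a map identifying non-adjacent vertices.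
Hom : ∀ {N m} → (Fin N → Fin N → ℕ) → Graph m → ℕ → Set
Hom {N} {m} κ F i = Σ (Fin m → Fin N) λ f → ∀ a b → F a b ≡ true → f a ≢ f b × κ (f a) (f b) ≡ i

-- A vertex adjacent to all others pins a monochromatic copy to one block: in a colour of the inner
-- factor no edge leaves the block of the root.
record Rooted {m} (F : Graph m) : Set where
  field
    root   : Fin m
    edge   : ∀ a → a ≢ root → F root a ≡ true
    irrefl : ∀ a → F a a ≢ true

-- `H1` stands for both choices of H: a colouring without it has no `H2` either.
forbidden : ℕ → ℕ → Σ ℕ Graph
forbidden r i = if i <ᵇ r then (5 , H1) else (3 , K3)

forbidden-rooted : ∀ r i → Rooted (proj₂ (forbidden r i))
forbidden-rooted r i with i <ᵇ r
... | true = record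
  { root = 0F
  ; edge = from-yes (all? {n = 5} λ a → ¬? (a ≟ 0F) →-dec (H1 0F a Bool.≟ true))
  ; irrefl = from-yes (all? {n = 5} λ a → ¬? (H1 a a Bool.≟ true)) }
... | false = record
  { root = 0F
  ; edge = from-yes (all? {n = 3} λ a → ¬? (a ≟ 0F) →-dec (K3 0F a Bool.≟ true))
  ; irrefl = from-yes (all? {n = 3} λ a → ¬? (K3 a a Bool.≟ true)) }

-- `r` is the final number of H-colours, while `K` counts the colours available so far. Colours
-- below `r` belong to H, so the factors for H come innermost.
record Lower (r K N : ℕ) : Set where
  field
    κ        : Fin N → Fin N → ℕ
    κ-sym    : ∀ x y → κ x y ≡ κ y x
    κ-bound  : ∀ {x y} → x ≢ y → κ x y < K
    κ-gallai : ∀ {x y z} → x ≢ y → y ≢ z → x ≢ z → ¬ (κ x y ≢ κ y z × κ y z ≢ κ x z × κ x y ≢ κ x z)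
    κ-free   : ∀ i → ¬ Copy κ (proj₂ (forbidden r i)) i

-- At most two colours occur between blocks, so three blocks never give a rainbow triangle; `A` and
-- `B` may coincide.
record Outer (r K K' m : ℕ) : Set where
  field
    o      : Fin m → Fin m → ℕ
    o-sym  : ∀ x y → o x y ≡ o y x
    A B    : ℕ
    o-two  : ∀ x y → o x y ≡ A ⊎ o x y ≡ B
    bounds : (K ≤ A × A < K') × (K ≤ B × B < K')
    o-free : ∀ i → K ≤ i → ¬ Hom o (proj₂ (forbidden r i)) i

module Product {r K K' m N} (O : Outer r K K' m) (L : Lower r K N) where
  open Outer O
  open Lower L

  block : Fin (m * N) → Fin m
  block x = proj₁ (remQuot {m} N x)

  inner : Fin (m * N) → Fin N
  inner x = proj₂ (remQuot {m} N x)

  pair-injective : ∀ {x y} → block x ≡ block y → inner x ≡ inner y → x ≡ y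
  pair-injective {x} {y} p q = trans (sym (combine-remQuot {m} N x)) (trans (cong₂ combine p q) (combine-remQuot {m} N y))

  o-range : ∀ x y → K ≤ o x y × o x y < K'
  o-range x y with o-two x y
  ... | inj₁ e = subst (λ v → K ≤ v × v < K') (sym e) (proj₁ bounds)
  ... | inj₂ e = subst (λ v → K ≤ v × v < K') (sym e) (proj₂ bounds)

  κ' : Fin (m * N) → Fin (m * N) → ℕ
  κ' x y with block x ≟ block y
  ... | yes _ = κ (inner x) (inner y)
  ... | no  _ = o (block x) (block y)

  κ'-same : ∀ {x y} → block x ≡ block y → κ' x y ≡ κ (inner x) (inner y)
  κ'-same {x} {y} e with block x ≟ block y
  ... | yes _ = refl
  ... | no ne = contradiction e ne

  κ'-diff : ∀ {x y} → block x ≢ block y → κ' x y ≡ o (block x) (block y)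
  κ'-diff {x} {y} ne with block x ≟ block y
  ... | yes e = contradiction e ne
  ... | no _  = refl

  κ'-sym : ∀ x y → κ' x y ≡ κ' y x
  κ'-sym x y with block x ≟ block y
  ... | yes e = trans (κ-sym _ _) (sym (κ'-same (sym e)))
  ... | no ne = trans (o-sym _ _) (sym (κ'-diff (≢-sym ne)))

  inner-≢ : ∀ {x y} → x ≢ y → block x ≡ block y → inner x ≢ inner y
  inner-≢ x≢y e q = x≢y (pair-injective e q)

  two-values : ∀ u v w {A B : ℕ} → u ≡ A ⊎ u ≡ B → v ≡ A ⊎ v ≡ B → w ≡ A ⊎ w ≡ B → ¬ (u ≢ v × v ≢ w × u ≢ w)
  two-values u v w (inj₁ refl) (inj₁ refl) _ (p , _) = p refl
  two-values u v w (inj₂ refl) (inj₂ refl) _ (p , _) = p refl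
  two-values u v w (inj₁ refl) _ (inj₁ refl) (_ , _ , p) = p refl
  two-values u v w (inj₂ refl) _ (inj₂ refl) (_ , _ , p) = p refl
  two-values u v w _ (inj₁ refl) (inj₁ refl) (_ , p , _) = p refl
  two-values u v w _ (inj₂ refl) (inj₂ refl) (_ , p , _) = p refl

  κ'-gallai : ∀ {x y z} → x ≢ y → y ≢ z → x ≢ z → ¬ (κ' x y ≢ κ' y z × κ' y z ≢ κ' x z × κ' x y ≢ κ' x z)
  κ'-gallai {x} {y} {z} xy yz xz (p , q , s) = by-blocks (block x ≟ block y) (block y ≟ block z) (block x ≟ block z)
    where
    by-blocks : Dec (block x ≡ block y) → Dec (block y ≡ block z) → Dec (block x ≡ block z) → ⊥
    by-blocks (yes e) (yes f) _ = κ-gallai (inner-≢ xy e) (inner-≢ yz f) (inner-≢ xz (trans e f))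
      ( (λ t → p (trans (κ'-same e) (trans t (sym (κ'-same f)))))
      , (λ t → q (trans (κ'-same f) (trans t (sym (κ'-same (trans e f))))))
      , (λ t → s (trans (κ'-same e) (trans t (sym (κ'-same (trans e f)))))))
    -- Two vertices of one block see a third vertex outside it in the same colour.
    by-blocks (yes e) (no f) _ = q (trans (κ'-diff f) (trans (cong (λ b → o b (block z)) (sym e)) (sym (κ'-diff (λ t → f (trans (sym e) t))))))
    by-blocks (no e) (yes f) _ = s (trans (κ'-diff e) (trans (cong (o (block x)) f) (sym (κ'-diff (λ t → e (trans t (sym f)))))))
    by-blocks (no e) (no f) (yes g) = p (trans (κ'-diff e) (trans (o-sym _ _) (trans (cong (o (block y)) g) (sym (κ'-diff f)))))
    by-blocks (no e) (no f) (no g) = two-values (κ' x y) (κ' y z) (κ' x z) (two e) (two f) (two g) (p , q , s)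
      where
      two : ∀ {x y} → block x ≢ block y → κ' x y ≡ A ⊎ κ' x y ≡ B
      two {x} {y} ne = subst (λ v → v ≡ A ⊎ v ≡ B) (sym (κ'-diff ne)) (o-two (block x) (block y))

  -- A copy in a new colour has all its edges between blocks, so `block ∘ f` is a homomorphism into
  -- the outer factor. A copy in an old colour stays in the block of its root and projects to the
  -- inner factor.
  κ'-free : ∀ i → ¬ Copy κ' (proj₂ (forbidden r i)) i
  κ'-free i (f , f-inj , f-col) with suc i ≤? K
  ... | yes i<K = κ-free i (inner ∘ f , (λ {a} {b} e → f-inj (pair-injective (trans (sym (to-root a)) (to-root b)) e)) ,
                            λ a b e → trans (sym (κ'-same (trans (sym (to-root a)) (to-root b)))) (f-col a b e))
    where
    open Rooted (forbidden-rooted r i)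
    to-root : ∀ a → block (f root) ≡ block (f a)
    to-root a with a ≟ root
    ... | yes refl = refl
    ... | no  ne   = decidable-stable (block (f root) ≟ block (f a)) λ d →
      <⇒≱ i<K (≤-trans (proj₁ (o-range _ _)) (≤-reflexive (trans (sym (κ'-diff d)) (f-col root a (edge a ne)))))
  ... | no  i≮K = o-free i K≤i (block ∘ f , λ a b e → separated a b e , trans (sym (κ'-diff (separated a b e))) (f-col a b e))
    where
    open Rooted (forbidden-rooted r i)
    K≤i : K ≤ i
    K≤i = ≤-pred (≰⇒> i≮K)
    separated : ∀ a b → proj₂ (forbidden r i) a b ≡ true → block (f a) ≢ block (f b)
    separated a b e s = <⇒≱ (κ-bound (inner-≢ (λ t → irrefl a (subst (λ c → proj₂ (forbidden r i) a c ≡ true) (sym (f-inj t)) e)) s))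
      (≤-trans K≤i (≤-reflexive (trans (sym (f-col a b e)) (κ'-same s))))

  product : Lower r K' (m * N)
  product = record
    { κ = κ' ; κ-sym = κ'-sym ; κ-gallai = κ'-gallai ; κ-free = κ'-free ; κ-bound = bound }
    where
    bound : ∀ {x y} → x ≢ y → κ' x y < K'
    bound {x} {y} x≢y with block x ≟ block y
    ... | yes e = ≤-trans (κ-bound (inner-≢ x≢y e)) (≤-trans (proj₁ (proj₁ bounds)) (<⇒≤ (proj₂ (proj₁ bounds))))
    ... | no _  = proj₂ (o-range (block x) (block y))

open Product using (product)

-- The factors of the construction

distance-graph : ∀ m → (ℕ → Bool) → Graph m
distance-graph m D x y = D ∣ toℕ x - toℕ y ∣

-- Distances ±1 modulo 5.
pentagon : ℕ → Bool
pentagon 1 = true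
pentagon 4 = true
pentagon _ = false

-- The quadratic residues modulo 17.
paley : ℕ → Bool
paley 1  = true
paley 2  = true
paley 4  = true
paley 8  = true
paley 9  = true
paley 13 = true
paley 15 = true
paley 16 = true
paley _  = false

-- Each edge condition precedes the next vertex, so that deciding these statements by evaluation
-- prunes the search early.
TriangleFree K₄Free : ∀ {m} → Graph m → Bool → Set
TriangleFree g v = ∀ a b → a ≢ b → g a b ≡ v → ∀ c → a ≢ c → b ≢ c → g a c ≡ v → g b c ≢ v
K₄Free g v = ∀ a b → a ≢ b → g a b ≡ v → ∀ c → a ≢ c → b ≢ c → g a c ≡ v → g b c ≡ v →
  ∀ d → a ≢ d → b ≢ d → c ≢ d → g a d ≡ v → g b d ≡ v → g c d ≢ v

triangleFree? : ∀ {m} (g : Graph m) v → Dec (TriangleFree g v)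
triangleFree? g v = all? λ a → all? λ b → ¬? (a ≟ b) →-dec ((g a b Bool.≟ v) →-dec
  all? λ c → ¬? (a ≟ c) →-dec (¬? (b ≟ c) →-dec ((g a c Bool.≟ v) →-dec ¬? (g b c Bool.≟ v))))

K₄Free? : ∀ {m} (g : Graph m) v → Dec (K₄Free g v)
K₄Free? g v = all? λ a → all? λ b → ¬? (a ≟ b) →-dec ((g a b Bool.≟ v) →-dec
  all? λ c → ¬? (a ≟ c) →-dec (¬? (b ≟ c) →-dec ((g a c Bool.≟ v) →-dec ((g b c Bool.≟ v) →-dec
  all? λ d → ¬? (a ≟ d) →-dec (¬? (b ≟ d) →-dec (¬? (c ≟ d) →-dec ((g a d Bool.≟ v) →-dec ((g b d Bool.≟ v) →-dec ¬? (g c d Bool.≟ v)))))))))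

pentagon-triangle-free : ∀ v → TriangleFree (distance-graph 5 pentagon) v
pentagon-triangle-free true  = from-yes (triangleFree? (distance-graph 5 pentagon) true)
pentagon-triangle-free false = from-yes (triangleFree? (distance-graph 5 pentagon) false)

-- Both the graph and its complement: this is the colouring behind R(4,4) > 17.
paley-K₄-free : ∀ v → K₄Free (distance-graph 17 paley) v
paley-K₄-free true  = from-yes (K₄Free? (distance-graph 17 paley) true)
paley-K₄-free false = from-yes (K₄Free? (distance-graph 17 paley) false)

palette : ℕ → Bool → ℕ
palette K v = if v then K else suc K

palette-injective : ∀ K {u v} → palette K u ≡ palette K v → u ≡ v
palette-injective K {true}  {true}  e = refl
palette-injective K {false} {false} e = refl
palette-injective K {true}  {false} e = contradiction (sym e) 1+n≢n
palette-injective K {false} {true}  e = contradiction e 1+n≢n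

graph-outer : ∀ {r K m} (g : Graph m) → (∀ x y → g x y ≡ g y x) →
  (∀ i → K ≤ i → ¬ Hom (λ x y → palette K (g x y)) (proj₂ (forbidden r i)) i) → Outer r K (2 + K) m
graph-outer {r} {K} {m} g g-sym free = record
  { o = λ x y → palette K (g x y) ; A = K ; B = suc K
  ; o-sym = λ x y → cong (palette K) (g-sym x y)
  ; o-two = λ x y → two (g x y)
  ; bounds = (≤-refl , n≤1+n _) , (n≤1+n _ , ≤-refl)
  ; o-free = free }
  where
  two : ∀ v → palette K v ≡ K ⊎ palette K v ≡ suc K
  two true  = inj₁ refl
  two false = inj₂ refl

palette-bound : ∀ K v → palette K v < 2 + K
palette-bound K true  = n≤1+n _
palette-bound K false = ≤-refl

distance-sym : ∀ m D x y → distance-graph m D x y ≡ distance-graph m D y x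
distance-sym m D x y = cong D (∣-∣-comm (toℕ x) (toℕ y))

module _ {r K : ℕ} where

  same-side : ∀ {u v i} → palette K u ≡ i → palette K v ≡ i → v ≡ u
  same-side p q = palette-injective K (trans q (sym p))

  not-below : ∀ {i} → r ≤ i → (i <ᵇ r) ≢ true
  not-below {i} r≤i e = <⇒≱ (<ᵇ⇒< i r (subst T (sym e) tt)) r≤i

  pentagon-outer : r ≤ K → Outer r K (2 + K) 5
  pentagon-outer r≤K = graph-outer g (distance-sym 5 pentagon) free
    where
    g = distance-graph 5 pentagon
    free : ∀ i → K ≤ i → ¬ Hom (λ x y → palette K (g x y)) (proj₂ (forbidden r i)) i
    free i K≤i h with i <ᵇ r in below
    ... | true = not-below (≤-trans r≤K K≤i) below
    ... | false with f , hom ← h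
      with d₁ , e₁ ← hom 0F 1F refl | d₂ , e₂ ← hom 0F 2F refl | d₃ , e₃ ← hom 1F 2F refl =
      pentagon-triangle-free _ (f 0F) (f 1F) d₁ refl (f 2F) d₂ d₃ (same-side e₁ e₂) (same-side e₁ e₃)

  paley-outer : 2 + K ≤ r → Outer r K (2 + K) 17
  paley-outer K<r = graph-outer g (distance-sym 17 paley) free
    where
    g = distance-graph 17 paley
    free : ∀ i → K ≤ i → ¬ Hom (λ x y → palette K (g x y)) (proj₂ (forbidden r i)) i
    free i K≤i (f , hom) with i <ᵇ r in below
    ... | false = subst T below (<⇒<ᵇ (≤-trans (subst (_< 2 + K) (proj₂ (hom 0F 1F refl)) (palette-bound K _)) K<r))
    ... | true
      -- A homomorphism is injective on the K₄ of `H1`, so its image would contain a K₄.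
      with d₁ , e₁ ← hom 0F 1F refl | d₂ , e₂ ← hom 0F 2F refl | d₃ , e₃ ← hom 1F 2F refl
         | d₄ , e₄ ← hom 0F 3F refl | d₅ , e₅ ← hom 1F 3F refl | d₆ , e₆ ← hom 2F 3F refl =
      paley-K₄-free _ (f 0F) (f 1F) d₁ refl (f 2F) d₂ d₃ (same-side e₁ e₂) (same-side e₁ e₃)
        (f 3F) d₄ d₅ d₆ (same-side e₁ e₄) (same-side e₁ e₅) (same-side e₁ e₆)

  edge-outer : r ≤ K → Outer r K (1 + K) 2
  edge-outer r≤K = record
    { o = λ _ _ → K ; A = K ; B = K ; o-sym = λ _ _ → refl ; o-two = λ _ _ → inj₁ refl
    ; bounds = (≤-refl , ≤-refl) , (≤-refl , ≤-refl) ; o-free = free }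
    where
    K3-edge : ∀ a b → a ≢ b → K3 a b ≡ true
    K3-edge = from-yes (all? {n = 3} λ a → all? {n = 3} λ b → ¬? (a ≟ b) →-dec (K3 a b Bool.≟ true))
    free : ∀ i → K ≤ i → ¬ Hom {2} (λ _ _ → K) (proj₂ (forbidden r i)) i
    free i K≤i (f , hom) with i <ᵇ r in below
    ... | true = not-below (≤-trans r≤K K≤i) below
    ... | false with a , b , a<b , e ← pigeonhole ≤-refl f = proj₁ (hom a b (K3-edge a b λ { refl → <-irrefl refl a<b })) e

no-injection : ∀ {m N} → N < m → (f : Fin m → Fin N) → ¬ (∀ {a b} → f a ≡ f b → a ≡ b)
no-injection N<m f inj with a , b , a<b , e ← pigeonhole N<m f with refl ← inj e = <-irrefl refl a<b

lower-point : ∀ r → Lower r 0 1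
lower-point r = record
  { κ = λ _ _ → 0 ; κ-sym = λ _ _ → refl ; κ-bound = λ { {0F} {0F} ne → contradiction refl ne }
  ; κ-gallai = λ _ _ _ (p , _) → p refl ; κ-free = free }
  where
  free : ∀ i → ¬ Copy {1} (λ _ _ → 0) (proj₂ (forbidden r i)) i
  free i (f , inj , _) with i <ᵇ r
  ... | true  = no-injection {5} (s≤s (s≤s z≤n)) f inj
  ... | false = no-injection {3} (s≤s (s≤s z≤n)) f inj

-- K₄ avoids `H1` only for want of a fifth vertex. A homomorphism from `H1` exists, so K₄ cannot be
-- an outer factor and has to be the innermost one.
lower-K₄ : ∀ r → 1 ≤ r → Lower r 1 4
lower-K₄ (suc r) _ = record
  { κ = λ _ _ → 0 ; κ-sym = λ _ _ → refl ; κ-bound = λ _ → ≤-refl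
  ; κ-gallai = λ _ _ _ (p , _) → p refl ; κ-free = free }
  where
  free : ∀ i → ¬ Copy {4} (λ _ _ → 0) (proj₂ (forbidden (suc r) i)) i
  free zero (f , inj , _) = no-injection ≤-refl f inj
  free (suc i) (f , _ , col) with i <ᵇ r
  ... | true  with () ← col 0F 1F refl
  ... | false with () ← col 0F 1F refl

lower-H₂ : ∀ r K → K ≤ r → Lower r K (ψ K)
lower-H₂ r 0 _ = lower-point r
lower-H₂ r 1 1≤r = lower-K₄ r 1≤r
lower-H₂ r (suc (suc K)) K≤r = product (paley-outer K≤r) (lower-H₂ r K (≤-trans (n≤1+n K) (≤-trans (n≤1+n (suc K)) K≤r)))

lower : ∀ r s → Lower r (s + r) (φ s * ψ r)
lower r 0 = subst (Lower r r) (sym (*-identityˡ (ψ r))) (lower-H₂ r r ≤-refl)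
lower r 1 = product (edge-outer ≤-refl) (lower-H₂ r r ≤-refl)
lower r (suc (suc s)) = subst (Lower r (2 + s + r)) (sym (*-assoc 5 (φ s) (ψ r)))
  (product (pentagon-outer (m≤n+m r s)) (lower r s))

-- Values of the extremal function

even-or-odd : ∀ s → ∃ λ a → s ≡ a * 2 ⊎ s ≡ 1 + a * 2
even-or-odd zero = 0 , inj₁ refl
even-or-odd (suc s) with even-or-odd s
... | a , inj₁ e = a , inj₂ (cong suc e)
... | a , inj₂ e = suc a , inj₁ (cong suc e)

φ-even : ∀ a → φ (a * 2) ≡ 5 ^ a
φ-even zero    = refl
φ-even (suc a) = cong (5 *_) (φ-even a)

φ-odd : ∀ a → φ (1 + a * 2) ≡ 2 * 5 ^ a
φ-odd zero    = refl
φ-odd (suc a) = trans (cong (5 *_) (φ-odd a)) (exchange (5 ^ a))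
  where
  exchange : ∀ u → 5 * (2 * u) ≡ 2 * (5 * u)
  exchange = solve-∀

ψ-even : ∀ b → ψ (b * 2) ≡ 17 ^ b
ψ-even zero    = refl
ψ-even (suc b) = cong (17 *_) (ψ-even b)

ψ-odd : ∀ b → ψ (1 + b * 2) ≡ 4 * 17 ^ b
ψ-odd zero    = refl
ψ-odd (suc b) = trans (cong (17 *_) (ψ-odd b)) (exchange (17 ^ b))
  where
  exchange : ∀ u → 17 * (4 * u) ≡ 4 * (17 * u)
  exchange = solve-∀

even%2 : ∀ a → (a * 2) % 2 ≡ 0
even%2 a = m*n%n≡0 a 2

half : ∀ a → (a * 2) / 2 ≡ a
half a = m*n/n≡m a 2

odd%2 : ∀ a → (1 + a * 2) % 2 ≡ 1
odd%2 a = [m+kn]%n≡m%n 1 a 2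

grValue-φψ : ∀ s r → grValue s r ≡ φ s * ψ r + 1
grValue-φψ s r with even-or-odd s | even-or-odd r
... | a , inj₁ refl | b , inj₁ refl
  rewrite even%2 a | even%2 b | half a | half b | φ-even a | ψ-even b = refl
... | a , inj₂ refl | b , inj₁ refl
  rewrite odd%2 a | even%2 b | half a | half b | φ-odd a | ψ-even b = refl
... | a , inj₂ refl | b , inj₂ refl
  rewrite odd%2 a | odd%2 b | half a | half b | φ-odd a | ψ-odd b = cong (_+ 1) (identity (5 ^ a) (17 ^ b))
  where
  identity : ∀ u v → 8 * u * v ≡ (2 * u) * (4 * v)
  identity = solve-∀
... | a , inj₁ refl | b , inj₂ refl
  rewrite even%2 a | odd%2 b | half a | half b | φ-even a | ψ-odd b = cong (_+ 1) (identity (5 ^ a) (17 ^ b))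
  where
  identity : ∀ u v → 4 * u * v ≡ u * (4 * v)
  identity = solve-∀

-- From the construction and the bound to `Arrows`

H1⊆H : ∀ w a b → H1 a b ≡ true → graphH w a b ≡ true
H1⊆H useH1 a b e = e
H1⊆H useH2 = from-yes (all? {n = 5} λ a → all? {n = 5} λ b → (H1 a b Bool.≟ true) →-dec (H2 a b Bool.≟ true))

module _ (w : WhichH) {r k N : ℕ} (L : Lower r (suc k) N) where
  open Lower L

  arrows-fails : ∀ {m} → m ≤ N → ¬ Arrows (mixedFamily w (suc k) r) m
  arrows-fails {m} m≤N arrows = κ-free (toℕ i) (copy copy-i)
    where
    ι : Fin m → Fin N
    ι x = inject≤ x m≤N
    ι-≢ : ∀ {x y} → x ≢ y → ι x ≢ ι y
    ι-≢ x≢y e = x≢y (inject≤-injective m≤N m≤N _ _ e)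
    c : Coloring m (suc k)
    -- Off the diagonal the values are already below `suc k`; the reduction only moves them into
    -- `Fin`.
    c = record { col = λ x y → κ (ι x) (ι y) mod suc k ; sym = λ x y → cong (_mod suc k) (κ-sym (ι x) (ι y)) }
    gallai : Gallai c
    gallai x y z xy yz xz (p , q , s) = κ-gallai (ι-≢ xy) (ι-≢ yz) (ι-≢ xz)
      (p ∘ cong (_mod suc k) , q ∘ cong (_mod suc k) , s ∘ cong (_mod suc k))
    i = proj₁ (arrows c gallai)
    copy-i = proj₂ (arrows c gallai)
    colour : ∀ {x y} → x ≢ y → col c x y ≡ i → κ (ι x) (ι y) ≡ toℕ i
    colour x≢y e = trans (sym (m<n⇒m%n≡m (κ-bound (ι-≢ x≢y)))) (trans (sym (toℕ-fromℕ< _)) (cong toℕ e))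
    copy : HasMonoCopy c (proj₂ (mixedFamily w (suc k) r i)) i → Copy κ (proj₂ (forbidden r (toℕ i))) (toℕ i)
    copy with toℕ i <ᵇ r
    ... | true  = λ (f , inj , mono) → ι ∘ f , (λ e → inj (inject≤-injective m≤N m≤N _ _ e)) ,
      λ a b e → colour (λ q → irreflexive a b (inj q) e) (mono a b (H1⊆H w a b e))
      where
      irreflexive : ∀ a b → a ≡ b → H1 a b ≢ true
      irreflexive a b refl = from-yes (all? {n = 5} λ a → ¬? (H1 a a Bool.≟ true)) a
    ... | false = λ (f , inj , mono) → ι ∘ f , (λ e → inj (inject≤-injective m≤N m≤N _ _ e)) ,
      λ a b e → colour (λ q → irreflexive a b (inj q) e) (mono a b e)
      where
      irreflexive : ∀ a b → a ≡ b → K3 a b ≢ true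
      irreflexive a b refl = from-yes (all? {n = 3} λ a → ¬? (K3 a a Bool.≟ true)) a

-- The upper bound is reached by contradiction, so the existence of a copy has to be decidable. `P`
-- must respect pointwise equality because a function is recovered from its head and tail only
-- pointwise.
any-function? : ∀ m {n} {P : (Fin m → Fin n) → Set} → (∀ {f g} → (∀ i → f i ≡ g i) → P f → P g) →
  (∀ f → Dec (P f)) → Dec (∃ P)
any-function? zero    resp P? = map′ ([]ᶠ ,_) (λ (f , p) → resp (λ ()) p) (P? []ᶠ)
any-function? (suc m) resp P? = map′
  (λ (v , f , p) → v ∷ᶠ f , p)
  (λ (f , p) → f zero , f ∘ suc , resp (λ { zero → refl ; (suc i) → refl }) p)
  (any? λ v → any-function? m (λ eq → resp λ { zero → refl ; (suc i) → eq i }) (λ f → P? (v ∷ᶠ f)))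

hasMonoCopy? : ∀ {n k m} (c : Coloring n k) (F : Graph m) i → Dec (HasMonoCopy c F i)
hasMonoCopy? c F i = any-function? _ respects λ f →
  map′ (λ inj {a} {b} → inj a b) (λ inj a b → inj {a} {b}) (all? λ a → all? λ b → (f a ≟ f b) →-dec (a ≟ b))
  ×-dec all? λ a → all? λ b → (F a b Bool.≟ true) →-dec (col c (f a) (f b) ≟ i)
  where
  respects : ∀ {f g} → (∀ a → f a ≡ g a) →
    Injective _≡_ _≡_ f × (∀ a b → F a b ≡ true → col c (f a) (f b) ≡ i) →
    Injective _≡_ _≡_ g × (∀ a b → F a b ≡ true → col c (g a) (g b) ≡ i)
  respects eq (inj , mono) = (λ {a} {b} e → inj (trans (eq a) (trans e (sym (eq b))))) ,
    λ a b e → trans (cong₂ (col c) (sym (eq a)) (sym (eq b))) (mono a b e)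

mixedType : ℕ → ∀ {k} → Fin k → Ty
mixedType r i = if toℕ i <ᵇ r then H₂ else K₃

count-K₃ : ∀ k r → r ≤ k → sum {k} (isK₃ ∘ mixedType r) ≡ k ∸ r
count-K₃ zero    zero    _         = refl
count-K₃ (suc k) zero    _         = cong suc (count-K₃ k zero z≤n)
count-K₃ (suc k) (suc r) (s≤s r≤k) = count-K₃ k r r≤k

count-H₂ : ∀ k r → r ≤ k → sum {k} (isH₂ ∘ mixedType r) ≡ r
count-H₂ zero    zero    _         = refl
count-H₂ (suc k) zero    _         = count-H₂ k zero z≤n
count-H₂ (suc k) (suc r) (s≤s r≤k) = cong suc (count-H₂ k r r≤k)

module _ {n k} (c : Coloring n k) (gallai : Gallai c) where
  open Colored c gallai

  everything : Sub n
  everything = record { Mem = λ _ → ⊤ ; mem? = λ _ → yes tt }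

  K3-copy : ∀ {i} → HasClique 3 i everything → HasMonoCopy c K3 i
  K3-copy {i} (x , _ , cl) = x , (λ {a} {b} e → decidable-stable (a ≟ b) (λ ne → proj₁ (cl ne) e)) , λ a b e → proj₂ (cl (irreflexive a b e))
    where
    irreflexive : ∀ a b → K3 a b ≡ true → a ≢ b
    irreflexive = from-yes (all? {n = 3} λ a → all? {n = 3} λ b → (K3 a b Bool.≟ true) →-dec ¬? (a ≟ b))

  -- Vertex 4 of H2, adjacent to 0 and 1 only, is moved to the front.
  rotate : Fin 5 → Fin 5
  rotate 4F = 0F
  rotate 0F = 1F
  rotate 1F = 2F
  rotate 2F = 3F
  rotate 3F = 4F

  rotate-injective : ∀ a b → rotate a ≡ rotate b → a ≡ b
  rotate-injective = from-yes (all? {n = 5} λ a → all? {n = 5} λ b → (rotate a ≟ rotate b) →-dec (a ≟ b))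

  FrontAdjacent : Fin 5 → Set
  FrontAdjacent a = a ≡ 1F ⊎ a ≡ 2F

  H2-rotated : ∀ a b → H2 a b ≡ true →
    (rotate a ≡ 0F → FrontAdjacent (rotate b)) × (rotate b ≡ 0F → FrontAdjacent (rotate a)) × rotate a ≢ rotate b
  H2-rotated = from-yes (all? {n = 5} λ a → all? {n = 5} λ b → (H2 a b Bool.≟ true) →-dec
    (((rotate a ≟ 0F) →-dec ((rotate b ≟ 1F) ⊎-dec (rotate b ≟ 2F)))
    ×-dec ((rotate b ≟ 0F) →-dec ((rotate a ≟ 1F) ⊎-dec (rotate a ≟ 2F)))
    ×-dec ¬? (rotate a ≟ rotate b)))

  H2-copy : ∀ {i} → ¬ HasMonoCopy c H2 i → H₂Free i everything
  H2-copy {i} no-copy (x , _ , cl) {w} _ w≢x {m} {m'} m≢m' e e'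
    with p , p≢m , p≢m' , _ ← fresh m m' m'
    with q , q≢m , q≢m' , q≢p ← fresh m m' p = no-copy (f ∘ rotate , (λ {a} {b} eq → rotate-injective a b (f-injective _ _ eq)) ,
      λ a b ab → let l , l' , ne = H2-rotated a b ab in f-edge (rotate a) (rotate b) l l' ne)
    where
    -- The two neighbours of `w` are listed first, to become the images of vertices 0 and 1 of `H2`.
    π : Fin 4 → Fin 4
    π = m ∷ᶠ m' ∷ᶠ p ∷ᶠ q ∷ᶠ []ᶠ
    f : Fin 5 → Fin n
    f = w ∷ᶠ x ∘ π
    distinct : ∀ {a b} → a ≢ b → π a ≢ π b
    distinct {0F} {0F} ne = contradiction refl ne
    distinct {1F} {1F} ne = contradiction refl ne
    distinct {2F} {2F} ne = contradiction refl ne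
    distinct {3F} {3F} ne = contradiction refl ne
    distinct {0F} {1F} _ = m≢m'
    distinct {0F} {2F} _ = ≢-sym p≢m
    distinct {0F} {3F} _ = ≢-sym q≢m
    distinct {1F} {0F} _ = ≢-sym m≢m'
    distinct {1F} {2F} _ = ≢-sym p≢m'
    distinct {1F} {3F} _ = ≢-sym q≢m'
    distinct {2F} {0F} _ = p≢m
    distinct {2F} {1F} _ = p≢m'
    distinct {2F} {3F} _ = ≢-sym q≢p
    distinct {3F} {0F} _ = q≢m
    distinct {3F} {1F} _ = q≢m'
    distinct {3F} {2F} _ = q≢p
    f-injective : ∀ a b → f a ≡ f b → a ≡ b
    f-injective zero    zero    _  = refl
    f-injective zero    (suc b) eq = contradiction eq (w≢x (π b))
    f-injective (suc a) zero    eq = contradiction (sym eq) (w≢x (π a))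
    f-injective (suc a) (suc b) eq = decidable-stable (suc a ≟ suc b) λ ne → proj₁ (cl (distinct (ne ∘ cong suc))) eq
    front : ∀ {b} → FrontAdjacent b → E i w (f b)
    front (inj₁ refl) = e
    front (inj₂ refl) = e'
    f-edge : ∀ a b → (a ≡ 0F → FrontAdjacent b) → (b ≡ 0F → FrontAdjacent a) → a ≢ b → χ (f a) (f b) ≡ i
    f-edge zero    b       l l' ne = proj₂ (front (l refl))
    f-edge (suc a) zero    l l' ne = proj₂ (E-sym (front (l' refl)))
    f-edge (suc a) (suc b) l l' ne = proj₂ (cl (distinct (ne ∘ cong suc)))

  avoids-mixed : ∀ w r i → ¬ HasMonoCopy c (proj₂ (mixedFamily w k r i)) i → Avoids (mixedType r i) i everything
  avoids-mixed w r i with toℕ i <ᵇ r | w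
  ... | false | _ = λ no-copy → no-copy ∘ K3-copy
  ... | true | useH2 = H2-copy
  ... | true | useH1 = λ no-copy → H2-copy λ (f , inj , mono) → no-copy (f , inj , λ a b e → mono a b (H1⊆H useH2 a b e))

  upper-arrows : ∀ w r → r ≤ k → φ (k ∸ r) * ψ r < n → ∃ λ i → HasMonoCopy c (proj₂ (mixedFamily w k r i)) i
  upper-arrows w r r≤k large = decidable-stable (any? λ i → hasMonoCopy? c (proj₂ (mixedFamily w k r i)) i) λ none →
    <⇒≱ large (begin
      n                           ≡⟨ size-full everything (λ _ → tt) ⟨
      size everything             ≤⟨ upper-bound _ everything (mixedType r) ≤-refl (λ i → avoids-mixed w r i (λ copy → none (i , copy))) ⟩
      extremal {k} (mixedType r)  ≡⟨ cong₂ (λ s r → φ s * ψ r) (count-K₃ k r r≤k) (count-H₂ k r r≤k) ⟩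
      φ (k ∸ r) * ψ r             ∎)
    where open ≤-Reasoning

theorem1p4 : ∀ (w : WhichH) (k r : ℕ) → 1 ≤ k → r ≤ k →
    IsGR (mixedFamily w k r) (grValue (k ∸ r) r)
theorem1p4 w (suc k) r _ r≤k rewrite grValue-φψ (suc k ∸ r) r =
  (λ c gallai → upper-arrows c gallai w r r≤k (≤-reflexive (+-comm 1 _))) ,
  λ m m< → arrows-fails w (subst (λ K → Lower r K (φ (suc k ∸ r) * ψ r)) (m∸n+n≡m r≤k) (lower r (suc k ∸ r)))
    (≤-pred (≤-trans m< (≤-reflexive (+-comm _ 1))))
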